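{- Let $\Delta,w\in\mathbb N$ and let $G$ be a digraph with maximum degree $\Delta$ and graded bandwidth $w$. Then $\vec r(G) \leq 3^{57\Delta w}|V(G)|$.
   Context: A digraph $G$ has graded bandwidth at most $w$ if its vertex set can be partitioned into sets $V_1,\dots,V_H$ such that for every edge $uv\in E(G)$ (directed from $u$ to $v$) with $u\in V_i$, $v\in V_j$ we have $1\leq j-i\leq w$ (in particular $G$ is acyclic); "graded bandwidth $w$" means graded bandwidth at most $w$. The maximum degree of a digraph is the maximum degree of its underlying undirected graph. A tournament is an orientation of a complete graph; for an acyclic digraph $G$, $\vec r(G)$ is the smallest $N$ such that every tournament on $N$ vertices contains a copy of $G$. -}

module Defs where

open import Data.Nat using (ℕ; suc; _+_; _≤_; _⊔_)
open import Data.Nat.ListAction using (sum)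
open import Data.Bool using (Bool; true; false; _∨_; if_then_else_)
open import Data.Fin using (Fin; toℕ)
open import Data.List using (foldr)
import Data.List as L
open import Data.Product using (Σ; _×_)
open import Data.Sum using (_⊎_)
open import Relation.Binary.PropositionalEquality using (_≡_; _≢_)
open import Function.Definitions using (Injective)

record Digraph (n : ℕ) : Set where
  field
    arc      : Fin n → Fin n → Bool
    loopless : ∀ v → arc v v ≡ false

open Digraph public

∣V∣ : ∀ {n} → Digraph n → ℕ
∣V∣ {n} _ = n

adj : ∀ {n} → Digraph n → Fin n → Fin n → Bool
adj G u v = arc G u v ∨ arc G v u

degree : ∀ {n} → Digraph n → Fin n → ℕ
degree {n} G v = sum (L.map (λ u → if adj G u v then 1 else 0) (L.allFin n))

maxDegree : ∀ {n} → Digraph n → ℕ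
maxDegree {n} G = foldr _⊔_ 0 (L.map (degree G) (L.allFin n))

-- G has graded bandwidth at most w: there are H ∈ ℕ and a partition of V(G)
-- into V_1, …, V_H (the part of v is level v) such that every arc u→v
-- satisfies 1 ≤ j - i ≤ w, where u ∈ V_i, v ∈ V_j.
HasGradedBandwidthAtMost : ∀ {n} → Digraph n → ℕ → Set
HasGradedBandwidthAtMost {n} G w =
  Σ ℕ λ H → Σ (Fin n → Fin H) λ level →
    ∀ u v → arc G u v ≡ true →
      (suc (toℕ (level u)) ≤ toℕ (level v)) × (toℕ (level v) ≤ toℕ (level u) + w)

record Tournament (N : ℕ) : Set where
  field
    beats     : Fin N → Fin N → Bool
    irrefl    : ∀ x → beats x x ≡ false
    total     : ∀ x y → x ≢ y → (beats x y ≡ true) ⊎ (beats y x ≡ true)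
    antisym   : ∀ x y → beats x y ≡ true → beats y x ≡ false

open Tournament public

ContainsCopy : ∀ {n N} → Tournament N → Digraph n → Set
ContainsCopy {n} {N} T G =
  Σ (Fin n → Fin N) λ φ → Injective _≡_ _≡_ φ ×
    (∀ u v → arc G u v ≡ true → beats T (φ u) (φ v) ≡ true)

Forces : ∀ {n} → ℕ → Digraph n → Set
Forces N G = ∀ (T : Tournament N) → ContainsCopy T G

-- r⃗(G) ≤ M, where r⃗(G) is the smallest N such that every tournament on
-- N vertices contains G: equivalently some N ≤ M has this property.
OrientedRamseyAtMost : ∀ {n} → Digraph n → ℕ → Set
OrientedRamseyAtMost G M = Σ ℕ λ N → N ≤ M × Forces N G

{-# OPTIONS --safe #-}
module Submission where

-- Group the levels of G into blocks of w consecutive levels, so that arcs stay inside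
-- a block or go to the next one.  In a median order of the tournament, a vertex receives
-- arcs from a constant proportion of any long enough interval preceding it, so an interval
-- can be assigned to each block, proceeding from the last block to the first.  Inside the
-- set P reserved for a block, dependent random choice, made greedily, is applied twice.
-- First, passing to common out-neighbours of vertices of the preceding interval I makes
-- almost all m-tuples of P have many common in-neighbours in I.  Then, passing
-- repeatedly to common in-neighbours of 2Δ vertices yields nested sets, one per level, such
-- that almost all tuples of at most Δ vertices from earlier sets have many common
-- out-neighbours in the current one; the m = 2Δw vertices chosen on the way form
-- a tuple with many common in-neighbours in I, and these are reserved for the preceding
-- block.  Finally G is embedded greedily from the sources, always choosing an image
-- that keeps the partially embedded in-neighbourhoods typical.

open import Defs
open import Data.Bool using (Bool; true; false; not; if_then_else_; T; _∨_)
open import Data.Bool.Properties using (T?)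
open import Data.Empty using (⊥; ⊥-elim)
open import Data.Fin using (Fin; toℕ; fromℕ<)
import Data.Fin.Properties as Fin
open import Data.List using (List; []; _∷_; _++_; map; length; filterᵇ; replicate; take; drop; allFin; foldr)
open import Data.List.Membership.Propositional using (_∈_; _∉_)
open import Data.List.Membership.Propositional.Properties using (∈-map⁺; ∈-++⁺ˡ; ∈-++⁺ʳ; ∈-filter⁺; ∈-filter⁻; ∈-∃++; ∈-allFin)
open import Data.List.Properties using (length-filter; length-++; length-map; length-take; length-drop; length-tabulate; filter-++; filter-none; ++-assoc; take++drop≡id; map-∘; map-cong; map-replicate)
open import Data.List.Relation.Binary.Permutation.Propositional using (_↭_; ↭-refl; ↭-sym; ↭-trans; ↭⇒↭ₛ)
open import Data.List.Relation.Binary.Permutation.Propositional.Properties as Perm using (↭-length; shift; filter-↭; ∈-resp-↭)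
import Data.List.Relation.Binary.Permutation.Setoid.Properties as PermSetoid
open import Data.List.Relation.Binary.Pointwise using (Pointwise; []; _∷_)
open import Data.List.Relation.Binary.Sublist.Propositional using (_⊆_; []; _∷_; _∷ʳ_; ⊆-refl; ⊆-trans; lookup)
open import Data.List.Relation.Binary.Sublist.Propositional.Properties using (length-mono-≤; filter⁺; filter-⊆; take-⊆; ++⁺ˡ; ++⁺ʳ; All-resp-⊆)
open import Data.List.Relation.Unary.All as All using (All; []; _∷_)
import Data.List.Relation.Unary.All.Properties as All
open import Data.List.Relation.Unary.AllPairs as AllPairs using (AllPairs; []; _∷_)
open import Data.List.Relation.Unary.Any using (here; there)
open import Data.List.Relation.Unary.Sorted.TotalOrder.Properties using (Sorted⇒AllPairs)
open import Data.List.Relation.Unary.Unique.Propositional using (Unique)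
open import Data.List.Relation.Unary.Unique.Propositional.Properties using (allFin⁺)
import Data.List.Sort as Sort
open import Data.Nat using (ℕ; zero; suc; _+_; _*_; _∸_; _^_; _⊓_; _⊔_; ⌊_/2⌋; _≤_; _<_; _<ᵇ_; _≤ᵇ_; _≡ᵇ_; _<?_; _≤?_; z≤n; s≤s; NonZero; >-nonZero)
open import Data.Nat.DivMod using (_/_; _%_; m%n<n; m≡m%n+[m/n]*n; /-monoˡ-≤; m/n≡1+[m∸n]/n)
open import Data.Nat.ListAction using (sum; product)
open import Data.Nat.Properties
open import Data.Nat.Tactic.RingSolver using (solve-∀)
open import Data.Product using (∃; _×_; _,_; proj₁; proj₂; uncurry)
open import Data.Sum using (_⊎_; inj₁; inj₂)
open import Data.Unit using (tt)
open import Function using (_∘_; id)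
open import Relation.Binary using (DecidableEquality)
open import Relation.Binary.Bundles using (DecTotalOrder)
import Relation.Binary.Construct.On as On
open import Relation.Binary.PropositionalEquality using (_≡_; _≢_; refl; sym; trans; cong; cong₂; subst; subst₂; setoid; module ≡-Reasoning)
open import Relation.Nullary using (Dec; does; yes; no)

-- Two demands on the constants compete. Dividing the number of bad tuples by `F` through one choice
-- requires a set whose size is a multiple of `F * θ`, and such a set is only a fraction of an
-- interval of `D * θ` vertices, so `D` exceeds `F` by a large factor. On the other hand, tuples of
-- Δ vertices range over sets of up to `D * θ` elements, while the embedding tolerates fewer than
-- `θ` to the power Δ bad ones, so a factor `D` has to be gained per coordinate. One choice per
-- coordinate would need `F > D`, which is impossible; two need only `F * F > D`, hence 2Δ choices
-- per level. Every backward choice also shrinks the candidates in the preceding interval. Nothing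
-- about the chosen vertices is known beforehand, so almost all tuples have to be harmless, and the
-- forward choices arrange this. Finally, the median order makes an interval dense towards a vertex
-- only if the gap between them is short compared with the interval. Blocks of very different sizes
-- would violate this, so their sizes are replaced by a slowly decreasing majorant.

private variable
  A B : Set

-- Weighted sums, counting and Markov's inequality

⟦_⟧ : Bool → ℕ
⟦ b ⟧ = if b then 1 else 0

∑ : List A → (A → ℕ) → ℕ
∑ xs f = sum (map f xs)

∑-mono-∈ : (xs : List A) {f g : A → ℕ} → (∀ {x} → x ∈ xs → f x ≤ g x) → ∑ xs f ≤ ∑ xs g
∑-mono-∈ [] h = z≤n
∑-mono-∈ (x ∷ xs) h = +-mono-≤ (h (here refl)) (∑-mono-∈ xs (h ∘ there))

∑-mono : (xs : List A) {f g : A → ℕ} → (∀ x → f x ≤ g x) → ∑ xs f ≤ ∑ xs g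
∑-mono xs h = ∑-mono-∈ xs (λ {x} _ → h x)

∑-cong : (xs : List A) {f g : A → ℕ} → (∀ x → f x ≡ g x) → ∑ xs f ≡ ∑ xs g
∑-cong xs h = cong sum (map-cong h xs)

∑-⊆ : {xs ys : List A} → xs ⊆ ys → (f : A → ℕ) → ∑ xs f ≤ ∑ ys f
∑-⊆ [] f = z≤n
∑-⊆ (y ∷ʳ s) f = ≤-trans (∑-⊆ s f) (m≤n+m _ (f y))
∑-⊆ (_∷_ {x = x} refl s) f = +-monoʳ-≤ (f x) (∑-⊆ s f)

∑-const : (xs : List A) (k : ℕ) → ∑ xs (λ _ → k) ≡ length xs * k
∑-const [] k = refl
∑-const (x ∷ xs) k = cong (k +_) (∑-const xs k)

∑-+ : (xs : List A) (f g : A → ℕ) → ∑ xs (λ x → f x + g x) ≡ ∑ xs f + ∑ xs g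
∑-+ [] f g = refl
∑-+ (x ∷ xs) f g = trans (cong (f x + g x +_) (∑-+ xs f g)) (shuffle (f x) (g x) (∑ xs f) (∑ xs g))
  where
  shuffle : ∀ a b c d → a + b + (c + d) ≡ a + c + (b + d)
  shuffle = solve-∀

∑-*ˡ : (xs : List A) (k : ℕ) (f : A → ℕ) → ∑ xs (λ x → k * f x) ≡ k * ∑ xs f
∑-*ˡ [] k f = sym (*-zeroʳ k)
∑-*ˡ (x ∷ xs) k f = trans (cong (k * f x +_) (∑-*ˡ xs k f)) (sym (*-distribˡ-+ k (f x) (∑ xs f)))

∑-swap : (xs : List A) (ys : List B) (f : A → B → ℕ) →
  ∑ xs (λ x → ∑ ys (f x)) ≡ ∑ ys (λ y → ∑ xs (λ x → f x y))
∑-swap [] ys f = sym (trans (∑-const ys 0) (*-zeroʳ (length ys)))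
∑-swap (x ∷ xs) ys f =
  trans (cong (∑ ys (f x) +_) (∑-swap xs ys f)) (sym (∑-+ ys (f x) (λ y → ∑ xs (λ x → f x y))))

∑-filterᵇ : (p : A → Bool) (xs : List A) (f : A → ℕ) →
  ∑ (filterᵇ p xs) f ≡ ∑ xs (λ x → if p x then f x else 0)
∑-filterᵇ p [] f = refl
∑-filterᵇ p (x ∷ xs) f with p x
... | true = cong (f x +_) (∑-filterᵇ p xs f)
... | false = ∑-filterᵇ p xs f

count : (A → Bool) → List A → ℕ
count p xs = length (filterᵇ p xs)

count-∷ : (p : A → Bool) (x : A) (xs : List A) → count p (x ∷ xs) ≡ ⟦ p x ⟧ + count p xs
count-∷ p x xs with p x
... | true = refl
... | false = refl

count-∑ : (p : A → Bool) (xs : List A) → count p xs ≡ ∑ xs (⟦_⟧ ∘ p)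
count-∑ p [] = refl
count-∑ p (x ∷ xs) = trans (count-∷ p x xs) (cong (⟦ p x ⟧ +_) (count-∑ p xs))

count-≤ : (p : A → Bool) (xs : List A) → count p xs ≤ length xs
count-≤ p = length-filter (T? ∘ p)

count-++ : (p : A → Bool) (xs ys : List A) → count p (xs ++ ys) ≡ count p xs + count p ys
count-++ p xs ys = trans (cong length (filter-++ (T? ∘ p) xs ys)) (length-++ (filterᵇ p xs))

filterᵇ-⊆ : (p : A → Bool) (xs : List A) → filterᵇ p xs ⊆ xs
filterᵇ-⊆ p = filter-⊆ (T? ∘ p)

filterᵇ-mono : (p : A → Bool) {xs ys : List A} → xs ⊆ ys → filterᵇ p xs ⊆ filterᵇ p ys
filterᵇ-mono p = filter⁺ (T? ∘ p) (T? ∘ p) (λ { refl t → t })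

count-⊆ : (p : A → Bool) {xs ys : List A} → xs ⊆ ys → count p xs ≤ count p ys
count-⊆ p s = length-mono-≤ (filterᵇ-mono p s)

T⇒≡ : {b : Bool} → T b → b ≡ true
T⇒≡ {true} _ = refl

≡⇒T : {b : Bool} → b ≡ true → T b
≡⇒T refl = tt

∈-filterᵇ⁻ : (p : A → Bool) {x : A} {xs : List A} → x ∈ filterᵇ p xs → x ∈ xs × p x ≡ true
∈-filterᵇ⁻ p {xs = xs} m with ∈-filter⁻ (T? ∘ p) {xs = xs} m
... | m′ , t = m′ , T⇒≡ t

count-split : (p : A → Bool) (xs : List A) → length xs ≡ count p xs + count (not ∘ p) xs
count-split p [] = refl
count-split p (x ∷ xs) with p x
... | true = cong suc (count-split p xs)
... | false = trans (cong suc (count-split p xs)) (sym (+-suc _ _))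

<ᵇ-true : {m n : ℕ} → (m <ᵇ n) ≡ true → m < n
<ᵇ-true {m} {n} e = <ᵇ⇒< m n (≡⇒T e)

<ᵇ-false : {m n : ℕ} → (m <ᵇ n) ≡ false → n ≤ m
<ᵇ-false {m} {n} e with m <? n
... | yes m<n = ⊥-elim (subst T e (<⇒<ᵇ m<n))
... | no m≮n = ≮⇒≥ m≮n

markov : (f : A → ℕ) (k c : ℕ) (xs : List A) → count (λ x → c <ᵇ k * f x) xs * suc c ≤ k * ∑ xs f
markov f k c [] = z≤n
markov f k c (x ∷ xs) with c <ᵇ k * f x in e
... | true = ≤-trans (+-mono-≤ (<ᵇ-true e) (markov f k c xs)) (≤-reflexive (sym (*-distribˡ-+ k (f x) _)))
... | false = ≤-trans (markov f k c xs) (*-monoʳ-≤ k (m≤n+m _ (f x)))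

-- Union bound; each "random" choice of the argument is made through it.
avoid-all : (bads : List (A → Bool)) (xs : List A) → ∑ bads (λ b → count b xs) < length xs →
  ∃ λ x → x ∈ xs × All (λ b → b x ≡ false) bads
avoid-all [] (x ∷ xs) _ = x , here refl , []
avoid-all (b ∷ bads) xs lt with avoid-all bads (filterᵇ (not ∘ b) xs) lt′
  where
  lt′ : ∑ bads (λ b′ → count b′ (filterᵇ (not ∘ b) xs)) < count (not ∘ b) xs
  lt′ = +-cancelˡ-< (count b xs) _ _ (<-≤-trans
    (≤-<-trans (+-monoʳ-≤ (count b xs) (∑-mono bads (λ b′ → count-⊆ b′ (filterᵇ-⊆ (not ∘ b) xs)))) lt)
    (≤-reflexive (count-split b xs)))
... | x , x∈ , al with ∈-filterᵇ⁻ (not ∘ b) {xs = xs} x∈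
... | x∈xs , nb = x , x∈xs , not-injective-false nb ∷ al
  where
  not-injective-false : {c : Bool} → not c ≡ true → c ≡ false
  not-injective-false {false} _ = refl

-- The number of tuples in the product of the given sets whose common
-- E-neighbourhood in X has fewer than thr elements.
badTuples : (E : A → B → Bool) (thr : ℕ) → List (List A) → List B → ℕ
badTuples E thr [] X = ⟦ length X <ᵇ thr ⟧
badTuples E thr (S ∷ Ss) X = ∑ S (λ a → badTuples E thr Ss (filterᵇ (E a) X))

-- Counts pairs of a bad tuple and a common neighbour `y` of it: a tuple survives the filtering by
-- `y` exactly when `y` is such a neighbour, and a bad tuple has fewer than `thr` of them. So an
-- average `y` keeps at most a `thr / length X` share of the bad tuples, badness still being
-- measured in all of `X`.
badTuples-double-count : (E : A → B → Bool) (thr : ℕ) (Ss : List (List A)) (X : List B) →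
  ∑ X (λ y → badTuples E thr (map (filterᵇ (λ a → E a y)) Ss) X) ≤ thr * badTuples E thr Ss X
badTuples-double-count E thr [] X with length X <ᵇ thr in e
... | true = subst₂ _≤_ (sym (∑-const X 1)) refl (*-monoˡ-≤ 1 (<⇒≤ (<ᵇ-true {length X} {thr} e)))
... | false = ≤-reflexive (trans (∑-const X 0) (trans (*-zeroʳ (length X)) (sym (*-zeroʳ thr))))
badTuples-double-count E thr (S ∷ Ss) X = begin
  ∑ X (λ y → ∑ (filterᵇ (λ a → E a y) S) (g y))
    ≡⟨ ∑-cong X (λ y → ∑-filterᵇ (λ a → E a y) S (g y)) ⟩
  ∑ X (λ y → ∑ S (λ a → if E a y then g y a else 0))
    ≡⟨ ∑-swap X S _ ⟩
  ∑ S (λ a → ∑ X (λ y → if E a y then g y a else 0))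
    ≡⟨ ∑-cong S (λ a → sym (∑-filterᵇ (E a) X (λ y → g y a))) ⟩
  ∑ S (λ a → ∑ (filterᵇ (E a) X) (λ y → g y a))
    ≤⟨ ∑-mono S (λ a → badTuples-double-count E thr Ss (filterᵇ (E a) X)) ⟩
  ∑ S (λ a → thr * badTuples E thr Ss (filterᵇ (E a) X))
    ≡⟨ ∑-*ˡ S thr _ ⟩
  thr * badTuples E thr (S ∷ Ss) X ∎
  where
  open ≤-Reasoning
  g = λ y a → badTuples E thr (map (filterᵇ (λ a → E a y)) Ss) (filterᵇ (E a) X)

badTuples-mono : (E : A → B → Bool) (thr : ℕ) {Ss Ts : List (List A)} → Pointwise _⊆_ Ss Ts →
  (X : List B) → badTuples E thr Ss X ≤ badTuples E thr Ts X
badTuples-mono E thr [] X = ≤-refl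
badTuples-mono E thr (_∷_ {x = S} s ss) X =
  ≤-trans (∑-mono S (λ a → badTuples-mono E thr ss (filterᵇ (E a) X))) (∑-⊆ s _)

⟦⟧≤1 : (b : Bool) → ⟦ b ⟧ ≤ 1
⟦⟧≤1 true = ≤-refl
⟦⟧≤1 false = z≤n

badTuples-≤-product : (E : A → B → Bool) (thr : ℕ) (Ss : List (List A)) (X : List B) →
  badTuples E thr Ss X ≤ product (map length Ss)
badTuples-≤-product E thr [] X = ⟦⟧≤1 (length X <ᵇ thr)
badTuples-≤-product E thr (S ∷ Ss) X =
  ≤-trans (∑-mono S (λ a → badTuples-≤-product E thr Ss (filterᵇ (E a) X)))
          (≤-reflexive (∑-const S (product (map length Ss))))

Unique-⊆ : {xs ys : List A} → xs ⊆ ys → Unique ys → Unique xs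
Unique-⊆ [] u = u
Unique-⊆ (y ∷ʳ s) (_ ∷ u) = Unique-⊆ s u
Unique-⊆ (refl ∷ s) (a ∷ u) = All-resp-⊆ s a ∷ Unique-⊆ s u

Unique-↭ : {xs ys : List A} → xs ↭ ys → Unique xs → Unique ys
Unique-↭ {A = A} p = PermSetoid.Unique-resp-↭ (setoid A) (↭⇒↭ₛ p)

Unique-++-∉ : (xs : List A) {ys : List A} {z : A} → Unique (xs ++ ys) → z ∈ xs → z ∈ ys → ⊥
Unique-++-∉ (x ∷ xs) (a ∷ _) (here refl) z∈ys = All.lookup a (∈-++⁺ʳ xs z∈ys) refl
Unique-++-∉ (x ∷ xs) (_ ∷ u) (there z∈xs) z∈ys = Unique-++-∉ xs u z∈xs z∈ys

-- Tournaments and median orders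

module Tournaments {V : Set} (E : V → V → Bool)
  (E-pair : ∀ {x y} → x ≢ y → ⟦ E x y ⟧ + ⟦ E y x ⟧ ≡ 1) where

  indegree : V → List V → ℕ
  indegree y = count (λ x → E x y)

  outdegree-indegree : (b : V) (xs : List V) → All (b ≢_) xs →
    indegree b xs + ∑ xs (λ x → ⟦ E b x ⟧) ≡ length xs
  outdegree-indegree b xs al = begin
    indegree b xs + ∑ xs (λ x → ⟦ E b x ⟧)
      ≡⟨ cong (_+ ∑ xs (λ x → ⟦ E b x ⟧)) (count-∑ _ xs) ⟩
    ∑ xs (λ x → ⟦ E x b ⟧) + ∑ xs (λ x → ⟦ E b x ⟧)
      ≡⟨ sym (∑-+ xs _ _) ⟩
    ∑ xs (λ x → ⟦ E x b ⟧ + ⟦ E b x ⟧)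
      ≡⟨ pairs xs al ⟩
    length xs ∎
    where
    open ≡-Reasoning
    pairs : (xs : List V) → All (b ≢_) xs → ∑ xs (λ x → ⟦ E x b ⟧ + ⟦ E b x ⟧) ≡ length xs
    pairs [] [] = refl
    pairs (x ∷ xs) (b≢x ∷ al) = cong₂ _+_ (E-pair (b≢x ∘ sym)) (pairs xs al)

  -- Every pair of distinct vertices carries an arc, so twice the number of arcs is at least n(n -
  -- 1); written without subtraction.
  indegree-sum : (B : List V) → Unique B →
    length B * length B ≤ 2 * ∑ B (λ y → indegree y B) + length B
  indegree-sum [] [] = z≤n
  indegree-sum (b ∷ B) (al ∷ u) = begin
    suc n * suc n                                      ≡⟨ square n ⟩
    n * n + (2 * n + 1)                                ≤⟨ +-monoˡ-≤ (2 * n + 1) (indegree-sum B u) ⟩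
    2 * s + n + (2 * n + 1)                            ≡⟨ regroup s n ⟩
    2 * (n + s) + suc n                                ≤⟨ +-monoˡ-≤ (suc n) (*-monoʳ-≤ 2 split) ⟩
    2 * ∑ (b ∷ B) (λ y → indegree y (b ∷ B)) + suc n   ∎
    where
    open ≤-Reasoning
    n = length B
    s = ∑ B (λ y → indegree y B)
    square : ∀ n → suc n * suc n ≡ n * n + (2 * n + 1)
    square = solve-∀
    regroup : ∀ s n → 2 * s + n + (2 * n + 1) ≡ 2 * (n + s) + suc n
    regroup = solve-∀
    split : n + s ≤ ∑ (b ∷ B) (λ y → indegree y (b ∷ B))
    split = begin
      n + s
        ≡⟨ cong (_+ s) (sym (outdegree-indegree b B al)) ⟩
      indegree b B + ∑ B (λ x → ⟦ E b x ⟧) + s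
        ≡⟨ +-assoc (indegree b B) _ s ⟩
      indegree b B + (∑ B (λ x → ⟦ E b x ⟧) + s)
        ≡⟨ cong (indegree b B +_) (sym (∑-+ B _ _)) ⟩
      indegree b B + ∑ B (λ y → ⟦ E b y ⟧ + indegree y B)
        ≤⟨ +-mono-≤ (≤-trans (m≤n+m _ ⟦ E b b ⟧) (≤-reflexive (sym (count-∷ _ b B))))
             (≤-reflexive (∑-cong B (λ y → sym (count-∷ _ b B)))) ⟩
      ∑ (b ∷ B) (λ y → indegree y (b ∷ B)) ∎

  lowIndegree : List V → V → Bool
  lowIndegree S y = 4 * indegree y S <ᵇ length S

  -- Inside the set B of low vertices the average indegree is at least (|B| - 1)/2, yet each of them
  -- has indegree below |S|/4 even in S. Comparing the two bounds |B| by about half of |S|.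
  few-lowIndegree : (S : List V) → Unique S → 2 * count (lowIndegree S) S ≤ suc (length S)
  few-lowIndegree S u with filterᵇ (lowIndegree S) S | filterᵇ-⊆ (lowIndegree S) S
                         | (λ {y} → ∈-filterᵇ⁻ (lowIndegree S) {y} {S})
  ... | [] | _ | _ = z≤n
  ... | B@(b ∷ B′) | B⊆S | low = *-cancelˡ-≤ (length B) (begin
    n * (2 * n)                  ≡⟨ double n ⟩
    2 * (n * n)                  ≤⟨ *-monoʳ-≤ 2 (indegree-sum B (Unique-⊆ B⊆S u)) ⟩
    2 * (2 * s + n)              ≡⟨ regroup s n ⟩
    4 * s + n + n                ≤⟨ +-monoˡ-≤ n few ⟩
    n * length S + n             ≡⟨ factor n (length S) ⟩
    n * suc (length S)           ∎)
    where
    open ≤-Reasoning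
    n = length B
    s = ∑ B (λ y → indegree y B)
    double : ∀ n → n * (2 * n) ≡ 2 * (n * n)
    double = solve-∀
    regroup : ∀ s n → 2 * (2 * s + n) ≡ 4 * s + n + n
    regroup = solve-∀
    factor : ∀ n k → n * k + n ≡ n * suc k
    factor = solve-∀
    few : 4 * s + n ≤ n * length S
    few = begin
      4 * s + n
        ≡⟨ cong₂ _+_ (sym (∑-*ˡ B 4 (λ y → indegree y B))) (sym (trans (∑-const B 1) (*-identityʳ n))) ⟩
      ∑ B (λ y → 4 * indegree y B) + ∑ B (λ _ → 1)
        ≡⟨ sym (∑-+ B (λ y → 4 * indegree y B) (λ _ → 1)) ⟩
      ∑ B (λ y → 4 * indegree y B + 1)
        ≤⟨ ∑-mono-∈ B (λ {y} y∈B → ≤-trans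
             (+-monoˡ-≤ 1 (*-monoʳ-≤ 4 (count-⊆ (λ x → E x y) B⊆S)))
             (≤-trans (≤-reflexive (+-comm (4 * indegree y S) 1)) (<ᵇ-true (proj₂ (low y∈B))))) ⟩
      ∑ B (λ _ → length S)
        ≡⟨ ∑-const B (length S) ⟩
      n * length S ∎

  -- Median orders are listed backwards: the arcs counted run from right to left.
  data Median : List V → Set where
    []  : Median []
    _∷_ : ∀ {y l} → (∀ ys zs → l ≡ ys ++ zs → length ys ≤ 2 * indegree y ys) →
          Median l → Median (y ∷ l)

  Median-++ : (xs : List V) {ys : List V} → Median (xs ++ ys) → Median ys
  Median-++ [] m = m
  Median-++ (x ∷ xs) (_ ∷ m) = Median-++ xs m

  Median-half : ∀ {y l} → Median (y ∷ l) → ∀ ys zs → l ≡ ys ++ zs → length ys ≤ 2 * indegree y ys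
  Median-half (half ∷ _) = half

  Violation : List V → Set
  Violation l = ∃ λ xs → ∃ λ y → ∃ λ ys → ∃ λ zs →
    l ≡ xs ++ y ∷ ys ++ zs × 2 * indegree y ys < length ys

  take-length-++ : (ys zs : List V) → take (length ys) (ys ++ zs) ≡ ys
  take-length-++ [] zs = refl
  take-length-++ (y ∷ ys) zs = cong (y ∷_) (take-length-++ ys zs)

  median? : (l : List V) → Median l ⊎ Violation l
  median? [] = inj₁ []
  median? (y ∷ l) with anyUpTo? (λ k → 2 * indegree y (take k l) <? length (take k l)) (suc (length l))
  ... | yes (k , _ , viol) =
    inj₂ ([] , y , take k l , drop k l , cong (y ∷_) (sym (take++drop≡id k l)) , viol)
  ... | no none with median? l
  ...   | inj₂ (xs , z , ys , zs , eq , viol) = inj₂ (y ∷ xs , z , ys , zs , cong (y ∷_) eq , viol)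
  ...   | inj₁ m = inj₁ (half ∷ m)
    where
    half : ∀ ys zs → l ≡ ys ++ zs → length ys ≤ 2 * indegree y ys
    half ys zs refl with 2 * indegree y ys <? length ys
    ... | no ¬viol = ≮⇒≥ ¬viol
    ... | yes viol = ⊥-elim (none (length ys
      , s≤s (≤-trans (m≤m+n (length ys) (length zs)) (≤-reflexive (sym (length-++ ys))))
      , subst (λ t → 2 * indegree y t < length t) (sym (take-length-++ ys zs)) viol))

  backArcs : List V → ℕ
  backArcs [] = 0
  backArcs (y ∷ l) = indegree y l + backArcs l

  backArcs-≤ : (l : List V) → backArcs l ≤ length l * length l
  backArcs-≤ [] = z≤n
  backArcs-≤ (y ∷ l) = ≤-trans (+-mono-≤ (≤-trans (count-≤ _ l) (n≤1+n _)) (backArcs-≤ l))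
    (+-monoʳ-≤ (suc (length l)) (*-monoʳ-≤ (length l) (n≤1+n _)))

  indegree-move : (x y : V) (ys zs : List V) →
    indegree x (ys ++ y ∷ zs) ≡ indegree x (y ∷ ys ++ zs)
  indegree-move x y ys zs = ↭-length (filter-↭ (T? ∘ λ z → E z x) (shift y ys zs))

  backArcs-insert : (y : V) (ys zs : List V) →
    backArcs (ys ++ y ∷ zs) ≡ ∑ ys (λ x → ⟦ E y x ⟧) + (indegree y zs + backArcs (ys ++ zs))
  backArcs-insert y [] zs = refl
  backArcs-insert y (x ∷ ys) zs = trans
    (cong₂ _+_ (trans (indegree-move x y ys zs) (count-∷ (λ z → E z x) y (ys ++ zs))) (backArcs-insert y ys zs))
    (shuffle ⟦ E y x ⟧ (indegree x (ys ++ zs)) (∑ ys (λ x → ⟦ E y x ⟧)) (indegree y zs) (backArcs (ys ++ zs)))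
    where
    shuffle : ∀ a b c d e → a + b + (c + (d + e)) ≡ a + c + (d + (b + e))
    shuffle = solve-∀

  -- A vertex that receives arcs from fewer than half of `ys` sends arcs to more than half. Carrying
  -- it across `ys` reverses the role of exactly these pairs.
  backArcs-improve : (xs : List V) (y : V) (ys zs : List V) → Unique (xs ++ y ∷ ys ++ zs) →
    2 * indegree y ys < length ys → backArcs (xs ++ y ∷ ys ++ zs) < backArcs (xs ++ ys ++ y ∷ zs)
  backArcs-improve (x ∷ xs) y ys zs (_ ∷ u) viol =
    +-mono-≤-< (≤-reflexive same) (backArcs-improve xs y ys zs u viol)
    where
    same : indegree x (xs ++ y ∷ ys ++ zs) ≡ indegree x (xs ++ ys ++ y ∷ zs)
    same = ↭-length (filter-↭ (T? ∘ λ z → E z x) (Perm.++⁺ˡ xs (↭-sym (shift y ys zs))))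
  backArcs-improve [] y ys zs (al ∷ _) viol = begin-strict
    indegree y (ys ++ zs) + backArcs (ys ++ zs)
      ≡⟨ cong (_+ backArcs (ys ++ zs)) (count-++ _ ys zs) ⟩
    indegree y ys + indegree y zs + backArcs (ys ++ zs)
      ≡⟨ +-assoc (indegree y ys) _ _ ⟩
    indegree y ys + (indegree y zs + backArcs (ys ++ zs))
      <⟨ +-monoˡ-< _ gain ⟩
    ∑ ys (λ x → ⟦ E y x ⟧) + (indegree y zs + backArcs (ys ++ zs))
      ≡⟨ sym (backArcs-insert y ys zs) ⟩
    backArcs (ys ++ y ∷ zs) ∎
    where
    open ≤-Reasoning
    gain : indegree y ys < ∑ ys (λ x → ⟦ E y x ⟧)
    gain = +-cancelˡ-< (indegree y ys) _ _ (begin-strict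
      indegree y ys + indegree y ys   ≡⟨ cong (indegree y ys +_) (sym (+-identityʳ _)) ⟩
      2 * indegree y ys               <⟨ viol ⟩
      length ys                       ≡⟨ sym (outdegree-indegree y ys (All-resp-⊆ (⊆-++ ys zs) al)) ⟩
      indegree y ys + ∑ ys (λ x → ⟦ E y x ⟧) ∎)
      where
      ⊆-++ : (ys zs : List V) → ys ⊆ ys ++ zs
      ⊆-++ ys zs = ++⁺ʳ zs ⊆-refl

  -- Local search: each violation yields a move that gains a counted arc, and there are at most
  -- `length l * length l` of those, which serves as fuel. An order without improving moves of this
  -- kind has the required half property.
  medianOrder : (l : List V) → Unique l → ∃ λ l′ → l′ ↭ l × Median l′
  medianOrder l u = search (length l * length l) l u
    (m≤m+n _ _) ↭-refl
    where
    search : (fuel : ℕ) (l′ : List V) → Unique l′ → length l * length l ≤ fuel + backArcs l′ →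
      l′ ↭ l → ∃ λ l″ → l″ ↭ l × Median l″
    search fuel l′ u′ bound p with median? l′
    ... | inj₁ m = l′ , p , m
    ... | inj₂ (xs , y , ys , zs , refl , viol) = improve fuel bound
      where
      moved = xs ++ ys ++ y ∷ zs
      q : moved ↭ xs ++ y ∷ ys ++ zs
      q = Perm.++⁺ˡ xs (shift y ys zs)
      better : backArcs l′ < backArcs moved
      better = backArcs-improve xs y ys zs u′ viol
      improve : (fuel : ℕ) → length l * length l ≤ fuel + backArcs l′ → ∃ λ l″ → l″ ↭ l × Median l″
      improve zero b = ⊥-elim (<-irrefl refl (≤-<-trans b (<-≤-trans better
        (subst (λ k → backArcs moved ≤ k * k) (↭-length (↭-trans q p)) (backArcs-≤ moved)))))
      improve (suc fuel) b = search fuel moved (Unique-↭ (↭-sym q) u′)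
        (≤-trans b (≤-trans (≤-reflexive (sym (+-suc fuel _))) (+-monoʳ-≤ fuel better))) (↭-trans q p)

-- Further counting lemmas for lists

∈-filterᵇ⁺ : (p : A → Bool) {x : A} {xs : List A} → x ∈ xs → p x ≡ true → x ∈ filterᵇ p xs
∈-filterᵇ⁺ p m e = ∈-filter⁺ (T? ∘ p) m (≡⇒T e)

filterᵇ-∷-true : (p : A → Bool) {x : A} (xs : List A) → p x ≡ true → filterᵇ p (x ∷ xs) ≡ x ∷ filterᵇ p xs
filterᵇ-∷-true p {x} xs e with p x
filterᵇ-∷-true p xs refl | true = refl

filterᵇ-∷-false : (p : A → Bool) {x : A} (xs : List A) → p x ≡ false → filterᵇ p (x ∷ xs) ≡ filterᵇ p xs
filterᵇ-∷-false p {x} xs e with p x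
filterᵇ-∷-false p xs refl | false = refl

filterᵇ-none : (p : A → Bool) {xs : List A} → All (λ x → p x ≡ false) xs → filterᵇ p xs ≡ []
filterᵇ-none p al = filter-none (T? ∘ p) (All.map (λ e t → subst T e t) al)

≤ᵇ-false : {m n : ℕ} → (m ≤ᵇ n) ≡ false → n < m
≤ᵇ-false {m} {n} e with m ≤? n
... | yes m≤n = ⊥-elim (subst T e (≤⇒≤ᵇ m≤n))
... | no m≰n = ≰⇒> m≰n

markov-≤ : (f : A → ℕ) (M : ℕ) (xs : List A) → count (λ x → M ≤ᵇ f x) xs * M ≤ ∑ xs f
markov-≤ f M [] = z≤n
markov-≤ f M (x ∷ xs) with M ≤ᵇ f x in e
... | true = +-mono-≤ (≤ᵇ⇒≤ M (f x) (≡⇒T e)) (markov-≤ f M xs)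
... | false = ≤-trans (markov-≤ f M xs) (m≤n+m _ (f x))

∑-map : (g : A → B) (xs : List A) (f : B → ℕ) → ∑ (map g xs) f ≡ ∑ xs (f ∘ g)
∑-map g xs f = cong sum (sym (map-∘ xs))

∑-++ : (xs ys : List A) (f : A → ℕ) → ∑ (xs ++ ys) f ≡ ∑ xs f + ∑ ys f
∑-++ [] ys f = refl
∑-++ (x ∷ xs) ys f = trans (cong (f x +_) (∑-++ xs ys f)) (sym (+-assoc (f x) _ _))

count-≟-≤1 : (_≟_ : DecidableEquality A) (e : A) {xs : List A} → Unique xs →
  count (λ x → does (x ≟ e)) xs ≤ 1
count-≟-≤1 _≟_ e [] = z≤n
count-≟-≤1 _≟_ e {x ∷ xs} (al ∷ u) with x ≟ e
... | no _ = count-≟-≤1 _≟_ e u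
... | yes refl = s≤s (≤-reflexive (cong length (filterᵇ-none (λ y → does (y ≟ e)) (All.map differ al))))
  where
  differ : ∀ {y} → e ≢ y → does (y ≟ e) ≡ false
  differ {y} e≢y with y ≟ e
  ... | yes refl = ⊥-elim (e≢y refl)
  ... | no _ = refl

-- Greedy embedding

module Override {U V : Set} (_≟_ : DecidableEquality U) where

  override : U → V → (U → V) → U → V
  override u x φ v = if does (v ≟ u) then x else φ v

  override-≡ : (u : U) (x : V) (φ : U → V) → override u x φ u ≡ x
  override-≡ u x φ with u ≟ u
  ... | yes _ = refl
  ... | no u≢u = ⊥-elim (u≢u refl)

  override-≢ : (u : U) (x : V) (φ : U → V) {v : U} → v ≢ u → override u x φ v ≡ φ v
  override-≢ u x φ {v} v≢u with v ≟ u
  ... | yes v≡u = ⊥-elim (v≢u v≡u)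
  ... | no _ = refl

-- Vertices are embedded in topological order, keeping for each remaining
-- vertex v the set X v of admissible images; the invariant on badTuples
-- forces X v to be large once all in-neighbours of v are embedded.
module Embedding {U V : Set} (_≟U_ : DecidableEquality U) (_≟V_ : DecidableEquality V)
  (arc : U → U → Bool) (irr : ∀ u → arc u u ≡ false) (E : V → V → Bool)
  (blk : U → ℕ) (θ : U → ℕ) (S : U → List V) (S-unique : ∀ u → Unique (S u)) (Δ : ℕ) where

  open Override {U} {V} _≟U_

  inNbrs : U → List U → List U
  inNbrs v = filterᵇ (λ u → arc u v)

  sameBlock : U → U → Bool
  sameBlock v u = blk u ≡ᵇ blk v

  sameBlock-true : ∀ u v → blk u ≡ blk v → sameBlock v u ≡ true
  sameBlock-true u v e = T⇒≡ (≡⇒≡ᵇ (blk u) (blk v) e)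

  bad : List U → U → List V → ℕ
  bad rest v = badTuples E (suc Δ * θ v) (map S (inNbrs v rest))

  record Embeds (rest : List U) (X excl : U → List V) : Set where
    field
      φ : U → V
      φ∈ : ∀ {v} → v ∈ rest → φ v ∈ X v
      φ∉ : ∀ {v} → v ∈ rest → φ v ∉ excl v
      φ-arc : ∀ {u v} → u ∈ rest → v ∈ rest → arc u v ≡ true → E (φ u) (φ v) ≡ true
      φ-inj : ∀ {u v} → u ∈ rest → v ∈ rest → u ≢ v → blk u ≡ blk v → φ u ≢ φ v

  -- There are at least `suc Δ * θ u` candidates for `u`. Each of its at most Δ out-neighbours
  -- forbids at most `θ u` of them, and the images already used in the block forbid fewer than
  -- `θ u`, because `u` itself still counts in `sameBlock`. Injectivity is claimed inside a block
  -- only; `excl` records the used images of that block.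
  embed : V → (rest : List U) (X excl : U → List V) →
    AllPairs (λ u v → arc v u ≡ false) rest → Unique rest →
    (∀ u → count (arc u) rest ≤ Δ) →
    (∀ {v} → v ∈ rest → X v ⊆ S v) →
    (∀ {v} → v ∈ rest → length (excl v) + count (sameBlock v) rest ≤ θ v) →
    (∀ {v} → v ∈ rest → bad rest v (X v) < product (map θ (inNbrs v rest))) →
    Embeds rest X excl
  embed x₀ [] X excl _ _ _ _ _ _ = record
    { φ = λ _ → x₀ ; φ∈ = λ () ; φ∉ = λ () ; φ-arc = λ () ; φ-inj = λ () }
  embed x₀ (u ∷ rest) X excl (topo ∷ topos) (u∉ ∷ uniq) outdeg X⊆S few small
    with avoid-all bads (X u) enough
    where
    outs = filterᵇ (arc u) rest
    Π : U → ℕ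
    Π v = product (map θ (inNbrs v rest))
    violates : U → V → Bool
    violates v x = Π v ≤ᵇ bad rest v (filterᵇ (E x) (X v))
    bads = map violates outs ++ map (λ e x → does (x ≟V e)) (excl u)
    no-inNbrs : inNbrs u (u ∷ rest) ≡ []
    no-inNbrs = filterᵇ-none _ (irr u ∷ topo)
    -- No in-neighbour of `u` is left, so the invariant speaks of the empty tuple: an indicator
    -- smaller than the empty product 1, hence false.
    large : suc Δ * θ u ≤ length (X u)
    large with length (X u) <ᵇ suc Δ * θ u in e
             | subst (λ l → badTuples E (suc Δ * θ u) (map S l) (X u) < product (map θ l)) no-inNbrs (small (here refl))
    ... | true | s≤s ()
    ... | false | _ = <ᵇ-false {length (X u)} e
    -- The coordinate of `u` in a tuple for `v` runs over all of `S u`, so Markov is applied to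
    -- `S u` and the bound is inherited by `X u`.
    few-violate : ∀ {v} → v ∈ outs → count (violates v) (X u) ≤ θ u
    few-violate {v} v∈ with ∈-filterᵇ⁻ (arc u) {xs = rest} v∈
    ... | v∈rest , u→v = ≤-trans (count-⊆ (violates v) (X⊆S (here refl)))
      (<⇒≤ (*-cancelʳ-< (Π v) _ _ (≤-<-trans
        (markov-≤ (λ x → bad rest v (filterᵇ (E x) (X v))) (Π v) (S u))
        (subst (λ l → badTuples E (suc Δ * θ v) (map S l) (X v) < product (map θ l))
          (filterᵇ-∷-true (λ u → arc u v) rest u→v) (small (there v∈rest))))))
    few-used : suc (length (excl u)) ≤ θ u
    few-used = ≤-trans
      (≤-trans (≤-reflexive (+-comm 1 (length (excl u))))
        (+-monoʳ-≤ (length (excl u)) (≤-trans (s≤s z≤n)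
          (≤-reflexive (cong length (sym (filterᵇ-∷-true (sameBlock u) rest (sameBlock-true u u refl))))))))
      (few (here refl))
    enough : ∑ bads (λ b → count b (X u)) < length (X u)
    enough = begin-strict
      ∑ bads (λ b → count b (X u))
        ≡⟨ ∑-++ (map violates outs) _ _ ⟩
      ∑ (map violates outs) (λ b → count b (X u)) + ∑ (map (λ e x → does (x ≟V e)) (excl u)) (λ b → count b (X u))
        ≡⟨ cong₂ _+_ (∑-map violates outs _) (∑-map _ (excl u) _) ⟩
      ∑ outs (λ v → count (violates v) (X u)) + ∑ (excl u) (λ e → count (λ x → does (x ≟V e)) (X u))
        ≤⟨ +-mono-≤ (∑-mono-∈ outs few-violate)
             (∑-mono (excl u) (λ e → count-≟-≤1 _≟V_ e (Unique-⊆ (X⊆S (here refl)) (S-unique u)))) ⟩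
      ∑ outs (λ _ → θ u) + ∑ (excl u) (λ _ → 1)
        ≡⟨ cong₂ _+_ (∑-const outs (θ u)) (trans (∑-const (excl u) 1) (*-identityʳ _)) ⟩
      length outs * θ u + length (excl u)
        <⟨ +-mono-≤-< (*-monoˡ-≤ (θ u) (≤-trans (length-mono-≤ (filterᵇ-mono (arc u) (u ∷ʳ ⊆-refl))) (outdeg u))) few-used ⟩
      Δ * θ u + θ u
        ≡⟨ +-comm (Δ * θ u) (θ u) ⟩
      suc Δ * θ u
        ≤⟨ large ⟩
      length (X u) ∎
      where open ≤-Reasoning
  ... | x , x∈X , ok = record { φ = φ ; φ∈ = φ∈ ; φ∉ = φ∉ ; φ-arc = φ-arc ; φ-inj = φ-inj }
    where
    outs = filterᵇ (arc u) rest
    X′ excl′ : U → List V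
    X′ v = if arc u v then filterᵇ (E x) (X v) else X v
    excl′ v = if sameBlock v u then x ∷ excl v else excl v

    X′⊆X : ∀ v → X′ v ⊆ X v
    X′⊆X v with arc u v
    ... | true = filterᵇ-⊆ (E x) (X v)
    ... | false = ⊆-refl

    few′ : ∀ {v} → v ∈ rest → length (excl′ v) + count (sameBlock v) rest ≤ θ v
    few′ {v} v∈ = ≤-trans (≤-reflexive eq) (few (there v∈))
      where
      eq : length (excl′ v) + count (sameBlock v) rest ≡ length (excl v) + count (sameBlock v) (u ∷ rest)
      eq with sameBlock v u
      ... | true = sym (+-suc (length (excl v)) _)
      ... | false = refl

    violated : ∀ {v} → v ∈ rest → arc u v ≡ true → bad rest v (filterᵇ (E x) (X v)) < product (map θ (inNbrs v rest))
    violated {v} v∈ u→v = ≤ᵇ-false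
      (All.lookup ok (∈-++⁺ˡ (∈-map⁺ _ (∈-filterᵇ⁺ (arc u) v∈ u→v))))

    small′ : ∀ {v} → v ∈ rest → bad rest v (X′ v) < product (map θ (inNbrs v rest))
    small′ {v} v∈ with arc u v in e
    ... | true = violated v∈ e
    ... | false = subst (λ l → badTuples E (suc Δ * θ v) (map S l) (X v) < product (map θ l))
                    (filterᵇ-∷-false (λ u → arc u v) rest e) (small (there v∈))

    rec : Embeds rest X′ excl′
    rec = embed x₀ rest X′ excl′ topos uniq
      (λ v → ≤-trans (length-mono-≤ (filterᵇ-mono (arc v) (u ∷ʳ ⊆-refl))) (outdeg v))
      (λ {v} v∈ → ⊆-trans (X′⊆X v) (X⊆S (there v∈))) few′ small′
    module R = Embeds rec

    φ : U → V
    φ = override u x R.φ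

    φ-u : φ u ≡ x
    φ-u = override-≡ u x R.φ

    φ-rest : ∀ {v} → v ∈ rest → φ v ≡ R.φ v
    φ-rest v∈ = override-≢ u x R.φ (λ { refl → All.lookup u∉ v∈ refl })

    φ∈ : ∀ {v} → v ∈ u ∷ rest → φ v ∈ X v
    φ∈ (here refl) = subst (_∈ X u) (sym φ-u) x∈X
    φ∈ {v} (there v∈) = subst (_∈ X v) (sym (φ-rest v∈)) (lookup (X′⊆X v) (R.φ∈ v∈))

    φ∉ : ∀ {v} → v ∈ u ∷ rest → φ v ∉ excl v
    φ∉ (here refl) m = subst (_∉ excl u) (sym φ-u) x∉ m
      where
      x∉ : x ∉ excl u
      x∉ x∈ with x ≟V x | All.lookup ok (∈-++⁺ʳ (map _ outs) (∈-map⁺ (λ e y → does (y ≟V e)) x∈))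
      ... | yes _ | ()
      ... | no x≢x | _ = x≢x refl
    φ∉ {v} (there v∈) m = R.φ∉ v∈ (excl⊆ (subst (_∈ excl v) (φ-rest v∈) m))
      where
      excl⊆ : ∀ {y} → y ∈ excl v → y ∈ excl′ v
      excl⊆ with sameBlock v u
      ... | true = there
      ... | false = id

    φ-arc : ∀ {v w} → v ∈ u ∷ rest → w ∈ u ∷ rest → arc v w ≡ true → E (φ v) (φ w) ≡ true
    φ-arc (here refl) (here refl) a with trans (sym a) (irr u)
    ... | ()
    φ-arc (here refl) (there {w} w∈) a = subst₂ (λ y z → E y z ≡ true) (sym φ-u) (sym (φ-rest w∈)) hit
      where
      hit : E x (R.φ _) ≡ true
      hit = proj₂ (∈-filterᵇ⁻ (E x) {xs = X _} (subst (λ b → R.φ _ ∈ (if b then filterᵇ (E x) (X _) else X _)) a (R.φ∈ w∈)))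
    φ-arc (there v∈) (here refl) a with trans (sym a) (All.lookup topo v∈)
    ... | ()
    φ-arc (there v∈) (there w∈) a =
      subst₂ (λ y z → E y z ≡ true) (sym (φ-rest v∈)) (sym (φ-rest w∈)) (R.φ-arc v∈ w∈ a)

    new : ∀ {v} → v ∈ rest → blk u ≡ blk v → R.φ v ≢ x
    new {v} v∈ e eq = R.φ∉ v∈ (subst (λ b → R.φ v ∈ (if b then x ∷ excl v else excl v))
      (sym (sameBlock-true u v e)) (here eq))

    φ-inj : ∀ {v w} → v ∈ u ∷ rest → w ∈ u ∷ rest → v ≢ w → blk v ≡ blk w → φ v ≢ φ w
    φ-inj (here refl) (here refl) v≢w _ _ = v≢w refl
    φ-inj (here refl) (there w∈) _ e eq = new w∈ e (trans (sym (φ-rest w∈)) (trans (sym eq) φ-u))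
    φ-inj (there v∈) (here refl) _ e eq = new v∈ (sym e) (trans (sym (φ-rest v∈)) (trans eq φ-u))
    φ-inj (there v∈) (there w∈) v≢w e eq =
      R.φ-inj v∈ w∈ v≢w e (trans (sym (φ-rest v∈)) (trans eq (φ-rest w∈)))

-- Bad tuples of mixed origin

cancel-suc : (k M c : ℕ) → k * suc c ≤ M * c → k ≤ M
cancel-suc k M c h = *-cancelʳ-≤ k M (suc c) (≤-trans h (*-monoʳ-≤ M (n≤1+n c)))

∑-two-level : (p : A → Bool) (f : A → ℕ) (s t : ℕ) → (∀ x → p x ≡ true → f x ≤ s) → (∀ x → f x ≤ t) →
  (xs : List A) → ∑ xs f ≤ count p xs * s + count (not ∘ p) xs * t
∑-two-level p f s t hs ht [] = z≤n
∑-two-level p f s t hs ht (x ∷ xs) with p x in e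
... | true = ≤-trans (+-mono-≤ (hs x e) (∑-two-level p f s t hs ht xs)) (≤-reflexive (sym (+-assoc s _ _)))
... | false = ≤-trans (+-mono-≤ (ht x) (∑-two-level p f s t hs ht xs))
  (≤-reflexive (swap t (count p xs * s) (count (not ∘ p) xs * t)))
  where
  swap : ∀ a b c → a + (b + c) ≡ b + (a + c)
  swap = solve-∀

-- Markov applied to the double count: all but `F * thr` choices of `y` divide the number of bad
-- tuples by `F`. The bound is independent of the size of `Y`, so it suffices that `Y` be large. If
-- there are no bad tuples, no `y` is counted at all, which `cancel-suc` covers without a case
-- split.
count-markov-tuples : {U W : Set} (E : U → W → Bool) (thr F : ℕ) (Ss : List (List U)) {Y X : List W} → Y ⊆ X →
  count (λ y → badTuples E thr Ss X <ᵇ F * badTuples E thr (map (filterᵇ (λ a → E a y)) Ss) X) Y ≤ F * thr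
count-markov-tuples E thr F Ss {Y} {X} Y⊆X = cancel-suc _ (F * thr) c (begin
  count (λ y → c <ᵇ F * f y) Y * suc c   ≤⟨ markov f F c Y ⟩
  F * ∑ Y f                              ≤⟨ *-monoʳ-≤ F (≤-trans (∑-⊆ Y⊆X f) (badTuples-double-count E thr Ss X)) ⟩
  F * (thr * c)                          ≡⟨ sym (*-assoc F thr c) ⟩
  F * thr * c                            ∎)
  where
  open ≤-Reasoning
  c = badTuples E thr Ss X
  f = λ y → badTuples E thr (map (filterᵇ (λ a → E a y)) Ss) X

-- A list of booleans is the type of an in-neighbourhood: `true` stands for a vertex of the
-- preceding block, `false` for one of an earlier level of the same block.
select : {X : Set} → X → X → Bool → X
select x y b = if b then x else y

map-filterᵇ-select : (q : A → Bool) (X Y : List A) (ts : List Bool) →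
  map (filterᵇ q) (map (select X Y) ts) ≡ map (select (filterᵇ q X) (filterᵇ q Y)) ts
map-filterᵇ-select q X Y ts = trans (sym (map-∘ ts)) (map-cong (λ { true → refl ; false → refl }) ts)

select-⊆ : {X X′ Y Y′ : List A} → X ⊆ X′ → Y ⊆ Y′ → (ts : List Bool) →
  Pointwise _⊆_ (map (select X Y) ts) (map (select X′ Y′) ts)
select-⊆ sx sy [] = []
select-⊆ sx sy (true ∷ ts) = sx ∷ select-⊆ sx sy ts
select-⊆ sx sy (false ∷ ts) = sy ∷ select-⊆ sx sy ts

product-select-length-≤ : {X Y : List A} {a b : ℕ} → length X ≤ a → length Y ≤ b → (ts : List Bool) →
  product (map length (map (select X Y) ts)) ≤ product (map (select a b) ts)
product-select-length-≤ hx hy [] = ≤-refl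
product-select-length-≤ hx hy (true ∷ ts) = *-mono-≤ hx (product-select-length-≤ hx hy ts)
product-select-length-≤ hx hy (false ∷ ts) = *-mono-≤ hy (product-select-length-≤ hx hy ts)

-- Dependent random choice inside one block

module Blocks {V : Set} (E : V → V → Bool)
  (E-pair : ∀ {x y} → x ≢ y → ⟦ E x y ⟧ + ⟦ E y x ⟧ ≡ 1) where

  open Tournaments E E-pair

  Eᵒ : V → V → Bool
  Eᵒ y x = E x y

  module Forward (I : List V) (m K t : ℕ) (|I|≡ : length I ≡ 16 * (K * t)) (1≤|I| : 1 ≤ length I) where

    badR : List V → ℕ
    badR Q = badTuples Eᵒ t (replicate m Q) I

    Shrinks : List V → V → Set
    Shrinks Q x = length Q ≤ 8 * count (E x) Q × K * badR (filterᵇ (E x) Q) ≤ badR Q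

    -- By density an average `x` in `I` sends arcs to a quarter of `Q`, so at least a seventh of `I`
    -- sends arcs to an eighth of `Q`. Only `K * t`, a sixteenth of `I`, fails to reduce the bad
    -- tuples.
    forward-step : (Q : List V) → 1 ≤ length Q → (∀ {y} → y ∈ Q → length I ≤ 4 * indegree y I) →
      ∃ (Shrinks Q)
    forward-step Q 1≤q dense = conclude (avoid-all (sparse ∷ heavy ∷ []) I enough)
      where
      q = length Q
      sparse heavy : V → Bool
      sparse x = 8 * count (E x) Q <ᵇ q
      heavy x = badR Q <ᵇ K * badTuples Eᵒ t (map (filterᵇ (λ a → Eᵒ a x)) (replicate m Q)) I
      α = count sparse I
      β = count heavy I
      good = count (not ∘ sparse) I
      16β≤ : 16 * β ≤ α + good
      16β≤ = ≤-trans (*-monoʳ-≤ 16 (count-markov-tuples Eᵒ t K (replicate m Q) (⊆-refl {x = I})))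
        (≤-reflexive (trans (sym |I|≡) (count-split sparse I)))
      arcs : 2 * (q * (α + good)) ≤ α * q + good * (8 * q)
      arcs = begin
        2 * (q * (α + good))               ≡⟨ cong (λ k → 2 * (q * k)) (sym (count-split sparse I)) ⟩
        2 * (q * length I)                 ≡⟨ cong (2 *_) (sym (∑-const Q (length I))) ⟩
        2 * ∑ Q (λ _ → length I)           ≤⟨ *-monoʳ-≤ 2 (∑-mono-∈ Q dense) ⟩
        2 * ∑ Q (λ y → 4 * indegree y I)   ≡⟨ cong (2 *_) (∑-*ˡ Q 4 (λ y → indegree y I)) ⟩
        2 * (4 * ∑ Q (λ y → indegree y I)) ≡⟨ sym (*-assoc 2 4 (∑ Q (λ y → indegree y I))) ⟩
        8 * ∑ Q (λ y → indegree y I)       ≡⟨ cong (8 *_) (∑-cong Q (λ y → count-∑ (λ x → E x y) I)) ⟩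
        8 * ∑ Q (λ y → ∑ I (λ x → ⟦ E x y ⟧)) ≡⟨ cong (8 *_) (∑-swap Q I (λ y x → ⟦ E x y ⟧)) ⟩
        8 * ∑ I (λ x → ∑ Q (λ y → ⟦ E x y ⟧)) ≡⟨ cong (8 *_) (∑-cong I (λ x → sym (count-∑ (E x) Q))) ⟩
        8 * ∑ I (λ x → count (E x) Q)      ≡⟨ sym (∑-*ˡ I 8 (λ x → count (E x) Q)) ⟩
        ∑ I (λ x → 8 * count (E x) Q)      ≤⟨ ∑-two-level sparse _ q (8 * q) (λ x e → <⇒≤ (<ᵇ-true e))
                                                (λ x → *-monoʳ-≤ 8 (count-≤ (E x) Q)) I ⟩
        α * q + good * (8 * q) ∎
        where open ≤-Reasoning
      |I|≤7good : α + good ≤ 7 * good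
      |I|≤7good = +-cancelˡ-≤ (α + good) _ _ (*-cancelˡ-≤ q {{>-nonZero 1≤q}} (begin
        q * (α + good + (α + good))  ≡⟨ e₁ q (α + good) ⟩
        2 * (q * (α + good))         ≤⟨ arcs ⟩
        α * q + good * (8 * q)       ≡⟨ e₂ q α good ⟩
        q * (α + good + 7 * good)    ∎))
        where
        open ≤-Reasoning
        e₁ : ∀ q k → q * (k + k) ≡ 2 * (q * k)
        e₁ = solve-∀
        e₂ : ∀ q a b → a * q + b * (8 * q) ≡ q * (a + b + 7 * b)
        e₂ = solve-∀
      β<good : β < good
      β<good with good in eq
      ... | zero = ⊥-elim (1+n≰n (≤-trans 1≤|I| (≤-trans (≤-reflexive (count-split sparse I))
                     (≤-trans |I|≤7good (≤-reflexive (cong (7 *_) eq))))))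
      ... | suc k = *-cancelˡ-< 16 β (suc k) (≤-<-trans 16β≤ (≤-<-trans |I|≤7good
                      (subst (λ j → 7 * j < 16 * suc k) (sym eq) (*-monoˡ-< (suc k) {7} {16} (m≤m+n 8 8)))))
      enough : ∑ (sparse ∷ heavy ∷ []) (λ b → count b I) < length I
      enough = begin-strict
        α + (β + 0)   ≡⟨ cong (α +_) (+-identityʳ β) ⟩
        α + β         <⟨ +-monoʳ-< α β<good ⟩
        α + good      ≡⟨ sym (count-split sparse I) ⟩
        length I      ∎
        where open ≤-Reasoning
      conclude : (∃ λ x → x ∈ I × All (λ b → b x ≡ false) (sparse ∷ heavy ∷ [])) → ∃ (Shrinks Q)
      conclude (x , _ , e₁ ∷ e₂ ∷ []) = x , <ᵇ-false {8 * count (E x) Q} e₁ ,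
        subst (λ l → K * badTuples Eᵒ t l I ≤ badR Q) (map-replicate (filterᵇ (E x)) m Q) (<ᵇ-false e₂)

    forward-phase : (j z : ℕ) → 1 ≤ z → (Q : List V) → (∀ {y} → y ∈ Q → length I ≤ 4 * indegree y I) →
      8 ^ j * z ≤ length Q →
      ∃ λ Q′ → Q′ ⊆ Q × z ≤ length Q′ × K ^ j * badR Q′ ≤ badR Q
    forward-phase zero z 1≤z Q dense h =
      Q , ⊆-refl , ≤-trans (≤-reflexive (sym (+-identityʳ z))) h , ≤-reflexive (+-identityʳ _)
    forward-phase (suc j) z 1≤z Q dense h =
      extend (forward-step Q (≤-trans (*-mono-≤ (m^n>0 8 (suc j)) 1≤z) h) dense)
      where
      extend : ∃ (Shrinks Q) → ∃ λ Q′ → Q′ ⊆ Q × z ≤ length Q′ × K ^ suc j * badR Q′ ≤ badR Q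
      extend (x , q≤ , bad≤) = combine (forward-phase j z 1≤z (filterᵇ (E x) Q)
        (λ y∈ → dense (lookup (filterᵇ-⊆ (E x) Q) y∈))
        (*-cancelˡ-≤ 8 (≤-trans (≤-reflexive (sym (*-assoc 8 (8 ^ j) z))) (≤-trans h q≤))))
        where
        combine : (∃ λ Q′ → Q′ ⊆ filterᵇ (E x) Q × z ≤ length Q′ × K ^ j * badR Q′ ≤ badR (filterᵇ (E x) Q)) →
          ∃ λ Q′ → Q′ ⊆ Q × z ≤ length Q′ × K ^ suc j * badR Q′ ≤ badR Q
        combine (Q′ , Q′⊆ , z≤ , bad≤′) = Q′ , ⊆-trans Q′⊆ (filterᵇ-⊆ (E x) Q) , z≤ , (begin
          K * K ^ j * badR Q′          ≡⟨ *-assoc K (K ^ j) _ ⟩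
          K * (K ^ j * badR Q′)        ≤⟨ *-monoʳ-≤ K bad≤′ ⟩
          K * badR (filterᵇ (E x) Q)   ≤⟨ bad≤ ⟩
          badR Q                       ∎)
          where open ≤-Reasoning

-- The shares 1/2, 1/8 and 1/8 leave a quarter of n, which absorbs the rounding in `suc n` as soon
-- as n is at least 2.
fewer-than-all : (n a b c : ℕ) → 2 ≤ n → 8 * a ≤ 4 * suc n → 8 * b < n → 8 * c ≤ n → a + (b + c) < n
fewer-than-all n a b c 2≤n 8a≤ 8b< 8c≤ = *-cancelˡ-< 8 _ _ (begin-strict
  8 * (a + (b + c))             ≡⟨ expand a b c ⟩
  8 * a + 8 * c + 8 * b         <⟨ +-mono-≤-< (+-mono-≤ 8a≤ 8c≤) 8b< ⟩
  4 * suc n + n + n             ≡⟨ collect n ⟩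
  6 * n + 2 * 2                 ≤⟨ +-monoʳ-≤ (6 * n) (*-monoʳ-≤ 2 2≤n) ⟩
  6 * n + 2 * n                 ≡⟨ sym (*-distribʳ-+ n 6 2) ⟩
  8 * n                         ∎)
  where
  open ≤-Reasoning
  expand : ∀ a b c → 8 * (a + (b + c)) ≡ 8 * a + 8 * c + 8 * b
  expand = solve-∀
  collect : ∀ n → 4 * suc n + n + n ≡ 6 * n + 2 * 2
  collect = solve-∀

scale-< : (L b p n : ℕ) → L * b < p → 8 * p ≤ L * n → 8 * b < n
scale-< L b p n L*b<p 8p≤ = *-cancelˡ-< L _ _ (begin-strict
  L * (8 * b)     ≡⟨ rearrange L b ⟩
  8 * (L * b)     <⟨ *-monoʳ-< 8 L*b<p ⟩
  8 * p           ≤⟨ 8p≤ ⟩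
  L * n           ∎)
  where
  open ≤-Reasoning
  rearrange : ∀ l b → l * (8 * b) ≡ 8 * (l * b)
  rearrange = solve-∀

module Backward {V : Set} (E : V → V → Bool)
  (E-pair : ∀ {x y} → x ≢ y → ⟦ E x y ⟧ + ⟦ E y x ⟧ ≡ 1)
  (Q : List V) (Q-unique : Unique Q) (t L p F thr : ℕ) (types : List (List Bool)) where

  open Tournaments E E-pair
  open Blocks E E-pair using (Eᵒ)
  open Override {ℕ} {List V} _≟_

  -- Extendable 0 Xp says that Xp has at least t elements.  The weaker form with k
  -- further vertices of Q still to be chosen survives each well-chosen step.
  Extendable : ℕ → List V → Set
  Extendable k Xp = L ^ k * badTuples Eᵒ t (replicate k Q) Xp < p ^ k

  badS : List V → List V → List V → List Bool → ℕ
  badS X Xp S ts = badTuples E thr (map (select Xp S) ts) X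

  J : ℕ
  J = length types

  Shrinks : ℕ → List V → List V → List V → V → Set
  Shrinks k S X Xp y = length S ≤ 4 * indegree y S ×
    Extendable k (filterᵇ (λ x → E x y) Xp) ×
    (∀ {ts} → ts ∈ types →
      F * badS X (filterᵇ (λ x → E x y) Xp) (filterᵇ (λ x → E x y) S) ts ≤ badS X Xp S ts)

  -- Three kinds of vertices of `S` are to be avoided: about half have low indegree, fewer than
  -- `p / L`, hence under an eighth of `S`, spoil extendability, and each type excludes at most
  -- `F * thr`. `Extendable` counts tuples over the fixed set `Q`, so it can be carried along while
  -- `S` shrinks.
  backward-step : (k : ℕ) (S X Xp : List V) → S ⊆ X → S ⊆ Q → 2 ≤ length S →
    8 * p ≤ L * length S → 8 * (J * (F * thr)) ≤ length S → Extendable (suc k) Xp →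
    ∃ (Shrinks k S X Xp)
  backward-step k S X Xp S⊆X S⊆Q 2≤S 8p≤ 8J≤ ext = conclude (avoid-all bads S enough)
    where
    n = length S
    tuples : V → ℕ
    tuples y = badTuples Eᵒ t (replicate k Q) (filterᵇ (λ x → E x y) Xp)
    blocks : V → Bool
    blocks y = p ^ k ≤ᵇ L ^ k * tuples y
    heavy : List Bool → V → Bool
    heavy ts y = badS X Xp S ts <ᵇ F * badTuples E thr (map (filterᵇ (λ x → E x y)) (map (select Xp S) ts)) X
    bads = lowIndegree S ∷ blocks ∷ map heavy types
    a = count (lowIndegree S) S
    b = count blocks S
    c = ∑ (map heavy types) (λ h → count h S)
    8a≤ : 8 * a ≤ 4 * suc n
    8a≤ = ≤-trans (≤-reflexive (*-assoc 4 2 a)) (*-monoʳ-≤ 4 (few-lowIndegree S (Unique-⊆ S⊆Q Q-unique)))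
    8c≤ : 8 * c ≤ n
    8c≤ = ≤-trans (*-monoʳ-≤ 8 (begin
      c                                      ≡⟨ ∑-map heavy types _ ⟩
      ∑ types (λ ts → count (heavy ts) S)    ≤⟨ ∑-mono types (λ ts → count-markov-tuples E thr F (map (select Xp S) ts) S⊆X) ⟩
      ∑ types (λ _ → F * thr)                ≡⟨ ∑-const types (F * thr) ⟩
      J * (F * thr)                          ∎)) 8J≤
      where open ≤-Reasoning
    L*b<p : L * b < p
    L*b<p = *-cancelʳ-< (p ^ k) _ _ (begin-strict
      L * b * p ^ k                          ≡⟨ *-assoc L b (p ^ k) ⟩
      L * (b * p ^ k)                        ≤⟨ *-monoʳ-≤ L (*-monoˡ-≤ (p ^ k) (count-⊆ blocks S⊆Q)) ⟩
      L * (count blocks Q * p ^ k)           ≤⟨ *-monoʳ-≤ L (markov-≤ _ (p ^ k) Q) ⟩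
      L * ∑ Q (λ y → L ^ k * tuples y)       ≡⟨ cong (L *_) (∑-*ˡ Q (L ^ k) tuples) ⟩
      L * (L ^ k * ∑ Q tuples)               ≡⟨ sym (*-assoc L (L ^ k) _) ⟩
      L ^ suc k * ∑ Q tuples                 <⟨ ext ⟩
      p * p ^ k                              ∎)
      where open ≤-Reasoning
    enough : ∑ bads (λ h → count h S) < n
    enough = fewer-than-all n a b c 2≤S 8a≤ (scale-< L b p n L*b<p 8p≤) 8c≤
    conclude : (∃ λ y → y ∈ S × All (λ h → h y ≡ false) bads) → ∃ (Shrinks k S X Xp)
    conclude (y , _ , low ∷ blk ∷ hs) = y , <ᵇ-false {4 * indegree y S} low , ≤ᵇ-false blk , light
      where
      light : ∀ {ts} → ts ∈ types →
        F * badS X (filterᵇ (λ x → E x y) Xp) (filterᵇ (λ x → E x y) S) ts ≤ badS X Xp S ts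
      light {ts} ts∈ = subst (λ l → F * badTuples E thr l X ≤ badS X Xp S ts)
        (map-filterᵇ-select (λ x → E x y) Xp S ts) (<ᵇ-false (All.lookup hs (∈-map⁺ _ ts∈)))

  -- `X` stays fixed while `S` and `Xp` shrink: it is the level in which tuples from `S` and `Xp`
  -- are to have many common out-neighbours.
  record Reduction (j k z : ℕ) (S X Xp : List V) : Set where
    field
      S′ Xp′ : List V
      S′⊆ : S′ ⊆ S
      Xp′⊆ : Xp′ ⊆ Xp
      z≤S′ : z ≤ length S′
      ext : Extendable k Xp′
      light : ∀ {ts} → ts ∈ types → F ^ j * badS X Xp′ S′ ts ≤ badS X Xp S ts

  backward-steps : (j k z : ℕ) → 2 ≤ z → 8 * p ≤ L * z → 8 * (J * (F * thr)) ≤ z →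
    (S X Xp : List V) → S ⊆ X → S ⊆ Q → 4 ^ j * z ≤ length S → Extendable (j + k) Xp →
    Reduction j k z S X Xp
  backward-steps zero k z _ _ _ S X Xp _ _ h ext = record
    { S′ = S ; Xp′ = Xp ; S′⊆ = ⊆-refl ; Xp′⊆ = ⊆-refl
    ; z≤S′ = ≤-trans (≤-reflexive (sym (+-identityʳ z))) h ; ext = ext ; light = λ _ → ≤-reflexive (+-identityʳ _) }
  backward-steps (suc j) k z 2≤z 8p≤ 8J≤ S X Xp S⊆X S⊆Q h ext = extend
    (backward-step (j + k) S X Xp S⊆X S⊆Q (≤-trans 2≤z z≤S) (≤-trans 8p≤ (*-monoʳ-≤ L z≤S)) (≤-trans 8J≤ z≤S) ext)
    where
    z≤S : z ≤ length S
    z≤S = ≤-trans (≤-trans (≤-reflexive (sym (*-identityˡ z))) (*-monoˡ-≤ z (m^n>0 4 (suc j)))) h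
    extend : ∃ (Shrinks (j + k) S X Xp) → Reduction (suc j) k z S X Xp
    extend (y , S≤ , ext₁ , light₁) = record
      { S′ = R.S′ ; Xp′ = R.Xp′ ; S′⊆ = ⊆-trans R.S′⊆ (filterᵇ-⊆ into-y S) ; Xp′⊆ = ⊆-trans R.Xp′⊆ (filterᵇ-⊆ into-y Xp)
      ; z≤S′ = R.z≤S′ ; ext = R.ext
      ; light = λ {ts} ts∈ → ≤-trans (≤-reflexive (*-assoc F (F ^ j) _)) (≤-trans (*-monoʳ-≤ F (R.light ts∈)) (light₁ ts∈)) }
      where
      into-y : V → Bool
      into-y x = E x y
      module R = Reduction (backward-steps j k z 2≤z 8p≤ 8J≤ (filterᵇ into-y S) X (filterᵇ into-y Xp)
        (⊆-trans (filterᵇ-⊆ into-y S) S⊆X) (⊆-trans (filterᵇ-⊆ into-y S) S⊆Q)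
        (*-cancelˡ-≤ 4 (≤-trans (≤-reflexive (sym (*-assoc 4 (4 ^ j) z))) (≤-trans h S≤))) ext₁)

  record Levels (w τ : ℕ) (S Xp : List V) (a b : ℕ) : Set where
    field
      Xp′ : List V
      Xp′⊆ : Xp′ ⊆ Xp
      ext : Extendable 0 Xp′
      level below : ℕ → List V
      level⊆ : ∀ {r} → r < w → level r ⊆ S
      level⊆below : ∀ {r r′} → r < w → r′ < r → level r′ ⊆ below r
      few-bad : ∀ {r ts} → r < w → ts ∈ types →
        F ^ τ * badS (level r) Xp′ (below r) ts ≤ product (map (select a b) ts)

  -- Levels are peeled off from the top: `S` itself becomes the highest level and its reduction `S₁`
  -- hosts all lower ones. Each level spends `τ` of the `w * τ` choices that `Extendable` has in
  -- store. Later shrinking of `Xp` only removes tuples, so the bounds of higher levels persist.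
  levels : (w τ z a b : ℕ) → 2 ≤ z → 8 * p ≤ L * z → 8 * (J * (F * thr)) ≤ z →
    (S Xp : List V) → S ⊆ Q → 4 ^ (w * τ) * z ≤ length S → length Xp ≤ a → length S ≤ b →
    Extendable (w * τ) Xp → Levels w τ S Xp a b
  levels zero τ z a b _ _ _ S Xp _ _ _ _ ext = record
    { Xp′ = Xp ; Xp′⊆ = ⊆-refl ; ext = ext ; level = λ _ → [] ; below = λ _ → []
    ; level⊆ = λ () ; level⊆below = λ () ; few-bad = λ () }
  levels (suc w) τ z a b 2≤z 8p≤ 8J≤ S Xp S⊆Q h Xp≤a S≤b ext = record
    { Xp′ = R.Xp′ ; Xp′⊆ = ⊆-trans R.Xp′⊆ Top.Xp′⊆ ; ext = R.ext ; level = level ; below = below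
    ; level⊆ = level⊆ ; level⊆below = level⊆below ; few-bad = few-bad }
    where
    z≤ : z ≤ 4 ^ (w * τ) * z
    z≤ = ≤-trans (≤-reflexive (sym (*-identityˡ z))) (*-monoˡ-≤ z (m^n>0 4 (w * τ)))
    pow : 4 ^ τ * (4 ^ (w * τ) * z) ≡ 4 ^ (τ + w * τ) * z
    pow = trans (sym (*-assoc (4 ^ τ) _ z)) (cong (_* z) (sym (^-distribˡ-+-* 4 τ (w * τ))))
    module Top = Reduction (backward-steps τ (w * τ) (4 ^ (w * τ) * z)
      (≤-trans 2≤z z≤) (≤-trans 8p≤ (*-monoʳ-≤ L z≤)) (≤-trans 8J≤ z≤)
      S S Xp ⊆-refl S⊆Q (≤-trans (≤-reflexive pow) h) ext)
    S₁ = Top.S′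
    module R = Levels (levels w τ z a b 2≤z 8p≤ 8J≤ S₁ Top.Xp′ (⊆-trans Top.S′⊆ S⊆Q) Top.z≤S′
      (≤-trans (length-mono-≤ Top.Xp′⊆) Xp≤a) (≤-trans (length-mono-≤ Top.S′⊆) S≤b) Top.ext)
    level below : ℕ → List V
    level = override w S R.level
    below = override w S₁ R.below

    level-old : ∀ {r} → r < w → level r ≡ R.level r
    level-old r<w = override-≢ w S R.level (<⇒≢ r<w)

    below-old : ∀ {r} → r < w → below r ≡ R.below r
    below-old r<w = override-≢ w S₁ R.below (<⇒≢ r<w)

    level⊆ : ∀ {r} → r < suc w → level r ⊆ S
    level⊆ {r} r< = cases (m<1+n⇒m<n∨m≡n r<)
      where
      cases : r < w ⊎ r ≡ w → level r ⊆ S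
      cases (inj₁ r<w) = subst (_⊆ S) (sym (level-old r<w)) (⊆-trans (R.level⊆ r<w) Top.S′⊆)
      cases (inj₂ refl) = subst (_⊆ S) (sym (override-≡ w S R.level)) ⊆-refl

    level⊆below : ∀ {r r′} → r < suc w → r′ < r → level r′ ⊆ below r
    level⊆below {r} {r′} r< r′<r = cases (m<1+n⇒m<n∨m≡n r<)
      where
      cases : r < w ⊎ r ≡ w → level r′ ⊆ below r
      cases (inj₁ r<w) = subst₂ _⊆_ (sym (level-old (<-trans r′<r r<w))) (sym (below-old r<w)) (R.level⊆below r<w r′<r)
      cases (inj₂ refl) = subst₂ _⊆_ (sym (level-old r′<r)) (sym (override-≡ w S₁ R.below)) (R.level⊆ r′<r)

    few-bad-top : ∀ {ts} → ts ∈ types → F ^ τ * badS S R.Xp′ S₁ ts ≤ product (map (select a b) ts)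
    few-bad-top {ts} ts∈ = begin
      F ^ τ * badS S R.Xp′ S₁ ts
        ≤⟨ *-monoʳ-≤ (F ^ τ) (badTuples-mono E thr (select-⊆ R.Xp′⊆ ⊆-refl ts) S) ⟩
      F ^ τ * badS S Top.Xp′ S₁ ts
        ≤⟨ Top.light ts∈ ⟩
      badS S Xp S ts
        ≤⟨ badTuples-≤-product E thr (map (select Xp S) ts) S ⟩
      product (map length (map (select Xp S) ts))
        ≤⟨ product-select-length-≤ Xp≤a S≤b ts ⟩
      product (map (select a b) ts) ∎
      where open ≤-Reasoning

    few-bad : ∀ {r ts} → r < suc w → ts ∈ types →
      F ^ τ * badS (level r) R.Xp′ (below r) ts ≤ product (map (select a b) ts)
    few-bad {r} {ts} r< ts∈ = cases (m<1+n⇒m<n∨m≡n r<)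
      where
      Bound : List V → List V → Set
      Bound top low = F ^ τ * badS top R.Xp′ low ts ≤ product (map (select a b) ts)
      cases : r < w ⊎ r ≡ w → Bound (level r) (below r)
      cases (inj₁ r<w) = subst₂ Bound (sym (level-old r<w)) (sym (below-old r<w)) (R.few-bad r<w ts∈)
      cases (inj₂ refl) = subst₂ Bound (sym (override-≡ w S R.level)) (sym (override-≡ w S₁ R.below)) (few-bad-top ts∈)

-- Types of in-neighbourhoods and the choice of constants

boolLists : ℕ → List (List Bool)
boolLists zero = [] ∷ []
boolLists (suc k) = [] ∷ map (true ∷_) (boolLists k) ++ map (false ∷_) (boolLists k)

∈-boolLists : (k : ℕ) (ts : List Bool) → length ts ≤ k → ts ∈ boolLists k
∈-boolLists zero [] _ = here refl
∈-boolLists (suc k) [] _ = here refl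
∈-boolLists (suc k) (true ∷ ts) (s≤s h) = there (∈-++⁺ˡ (∈-map⁺ _ (∈-boolLists k ts h)))
∈-boolLists (suc k) (false ∷ ts) (s≤s h) = there (∈-++⁺ʳ (map _ (boolLists k)) (∈-map⁺ _ (∈-boolLists k ts h)))

length-boolLists : (k : ℕ) → suc (length (boolLists k)) ≡ 2 ^ suc k
length-boolLists zero = refl
length-boolLists (suc k) = trans
  (cong (2 +_) (trans (length-++ (map (true ∷_) (boolLists k))) (cong₂ _+_ (length-map _ (boolLists k)) (length-map _ (boolLists k)))))
  (trans (double (length (boolLists k))) (cong (2 *_) (length-boolLists k)))
  where
  double : ∀ j → 2 + (j + j) ≡ 2 * suc j
  double = solve-∀

-- A spare power of 2 supplies the strict inequality demanded by the invariants. It is the reason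
-- for the factor 2 in `K` and for having `F * F = 2 * D`.
halve-strict : {k : ℕ} (b c : ℕ) → 1 ≤ k → 1 ≤ c → 2 ^ k * b ≤ c → b < c
halve-strict zero c _ 1≤c _ = 1≤c
halve-strict {suc k} (suc b) c _ _ h = begin-strict
  suc b                  <⟨ m<m+n (suc b) (s≤s z≤n) ⟩
  suc b + suc b          ≡⟨ cong (suc b +_) (sym (+-identityʳ (suc b))) ⟩
  2 * suc b              ≤⟨ *-monoˡ-≤ (suc b) (*-monoʳ-≤ 2 (m^n>0 2 k)) ⟩
  2 ^ suc k * suc b      ≤⟨ h ⟩
  c ∎
  where open ≤-Reasoning

indicator-<1 : (b : Bool) → 1 * ⟦ b ⟧ < 1 → b ≡ false
indicator-<1 false _ = refl
indicator-<1 true (s≤s ())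

product-length-replicate : (k : ℕ) (S : List A) → product (map length (replicate k S)) ≡ length S ^ k
product-length-replicate zero S = refl
product-length-replicate (suc k) S = cong (length S *_) (product-length-replicate k S)

product-select-scale : (D a b : ℕ) (ts : List Bool) →
  product (map (select (D * a) (D * b)) ts) ≡ D ^ length ts * product (map (select a b) ts)
product-select-scale D a b [] = refl
product-select-scale D a b (t ∷ ts) = trans (cong₂ _*_ (head t) (product-select-scale D a b ts))
  (interchange D (select a b t) (D ^ length ts) (product (map (select a b) ts)))
  where
  head : ∀ t → select (D * a) (D * b) t ≡ D * select a b t
  head true = refl
  head false = refl
  interchange : ∀ d s e q → d * s * (e * q) ≡ d * e * (s * q)
  interchange = solve-∀

product-select-≥1 : {a b : ℕ} → 1 ≤ a → 1 ≤ b → (ts : List Bool) → 1 ≤ product (map (select a b) ts)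
product-select-≥1 ha hb [] = ≤-refl
product-select-≥1 ha hb (true ∷ ts) = *-mono-≤ ha (product-select-≥1 ha hb ts)
product-select-≥1 ha hb (false ∷ ts) = *-mono-≤ hb (product-select-≥1 ha hb ts)

^-distribʳ-* : (k a b : ℕ) → (a * b) ^ k ≡ a ^ k * b ^ k
^-distribʳ-* zero a b = refl
^-distribʳ-* (suc k) a b = trans (cong (a * b *_) (^-distribʳ-* k a b)) (interchange a b (a ^ k) (b ^ k))
  where
  interchange : ∀ a b c d → a * b * (c * d) ≡ a * c * (b * d)
  interchange = solve-∀

abstract
  -- Half the product of the numerical factors in `Γ`, `K`, `L`, `R`, `Z` and `F`.
  scale : ℕ
  scale = 8192

  2*scale≡ : 2 * scale ≡ 16 * 2 * 8 * 4 * 8 * 2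
  2*scale≡ = refl

  scale≡ : scale ≡ 2 ^ 13
  scale≡ = refl

  1≤scale : 1 ≤ scale
  1≤scale = s≤s z≤n

-- The interval of block i has D θᵢ vertices, a 1/Γ fraction of which survives in the set
-- reserved for that block; K and F are the factors by which one forward, respectively
-- backward, choice reduces the bad tuples.  The argument needs D = ΓR and D < F².
module Constants (Δ w : ℕ) where

  τ m J x H F D L K Γ Z R : ℕ
  τ = 2 * Δ
  m = w * τ
  J = length (boolLists Δ)
  x = 8 ^ m * 4 ^ m
  H = scale * (x * x) * (J * suc Δ)
  F = 2 * H
  D = 2 * (H * H)
  -- Sets reserved for a block have `x * Z * θ` vertices, and `Z * θ` survive all choices, so
  -- `p / L` is an eighth of the final size. The 16 in `Γ` is the share of heavy vertices allowed in
  -- a forward choice; the 4 in `R` pays for passing to a quarter of an interval.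
  L = 8 * x
  K = 2 * L
  Γ = 16 * K
  Z = 8 * (J * (F * suc Δ))
  R = 4 * (x * Z)

  -- `R` contains `F`, hence `H`, linearly, whereas `D` is quadratic in `H`. Cancelling one `H`
  -- leaves the definition of `H`.
  D≡ΓR : D ≡ Γ * R
  D≡ΓR = begin
    2 * (H * H)                                             ≡⟨ lhs scale x (J * suc Δ) H ⟩
    2 * scale * (x * x * (J * suc Δ) * H)                   ≡⟨ cong (_* (x * x * (J * suc Δ) * H)) 2*scale≡ ⟩
    16 * 2 * 8 * 4 * 8 * 2 * (x * x * (J * suc Δ) * H)      ≡⟨ rhs 16 2 8 4 8 2 x J (suc Δ) H ⟩
    Γ * R                                                   ∎
    where
    open ≡-Reasoning
    lhs : ∀ c x y h → 2 * (c * (x * x) * y * h) ≡ 2 * c * (x * x * y * h)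
    lhs = solve-∀
    rhs : ∀ a b c d e f x j s h → a * b * c * d * e * f * (x * x * (j * s) * h) ≡
      a * (b * (c * x)) * (d * (x * (e * (j * (f * h * s)))))
    rhs = solve-∀

  1≤J : 1 ≤ J
  1≤J = pos Δ
    where
    pos : ∀ k → 1 ≤ length (boolLists k)
    pos zero = ≤-refl
    pos (suc k) = s≤s z≤n

  1≤x : 1 ≤ x
  1≤x = *-mono-≤ (m^n>0 8 m) (m^n>0 4 m)

  1≤H : 1 ≤ H
  1≤H = *-mono-≤ (*-mono-≤ 1≤scale (*-mono-≤ 1≤x 1≤x)) (*-mono-≤ 1≤J (s≤s z≤n))

  1≤D : 1 ≤ D
  1≤D = *-mono-≤ {1} {2} (s≤s z≤n) (*-mono-≤ 1≤H 1≤H)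

  2≤Z : 2 ≤ Z
  2≤Z = *-mono-≤ {2} {8} (s≤s (s≤s z≤n)) (*-mono-≤ 1≤J (*-mono-≤ (*-mono-≤ {1} {2} (s≤s z≤n) 1≤H) (s≤s z≤n)))

module Block {V : Set} (E : V → V → Bool)
  (E-pair : ∀ {x y} → x ≢ y → ⟦ E x y ⟧ + ⟦ E y x ⟧ ≡ 1) (Δ w : ℕ) (1≤Δ : 1 ≤ Δ) (1≤w : 1 ≤ w) where

  open Tournaments E E-pair
  open Blocks E E-pair
  open Constants Δ w

  record BlockLevels (P I : List V) (θ θ′ : ℕ) : Set where
    field
      P′ : List V
      P′⊆ : P′ ⊆ I
      large : length I ≤ Γ * length P′
      level below : ℕ → List V
      level⊆ : ∀ {r} → r < w → level r ⊆ P
      level⊆below : ∀ {r r′} → r < w → r′ < r → level r′ ⊆ below r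
      few-bad : ∀ {r} (ts : List Bool) → r < w → length ts ≤ Δ →
        badTuples E (suc Δ * θ) (map (select P′ (below r)) ts) (level r) < product (map (select θ′ θ) ts)

  1≤m : 1 ≤ m
  1≤m = *-mono-≤ 1≤w (*-mono-≤ {1} {2} (s≤s z≤n) 1≤Δ)

  blockLevels : (P I : List V) (θ θ′ : ℕ) → 1 ≤ θ → 1 ≤ θ′ → Unique P →
    length P ≡ 8 ^ m * (4 ^ m * (Z * θ)) → length P ≤ D * θ → length I ≡ D * θ′ →
    (∀ {y} → y ∈ P → length I ≤ 4 * indegree y I) → BlockLevels P I θ θ′
  blockLevels P I θ θ′ 1≤θ 1≤θ′ uniq |P|≡ |P|≤ |I|≡ dense = record
    { P′ = Lv.Xp′ ; P′⊆ = Lv.Xp′⊆ ; large = large ; level = Lv.level ; below = Lv.below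
    ; level⊆ = λ r< → ⊆-trans (Lv.level⊆ r<) Q⊆P ; level⊆below = Lv.level⊆below ; few-bad = few-bad }
    where
    open ≤-Reasoning
    z t thr p : ℕ
    z = Z * θ
    t = R * θ′
    thr = suc Δ * θ
    p = length P

    |I|≡Γt : length I ≡ Γ * t
    |I|≡Γt = trans |I|≡ (trans (cong (_* θ′) D≡ΓR) (*-assoc Γ R θ′))

    1≤I : 1 ≤ length I
    1≤I = subst (1 ≤_) (sym |I|≡) (*-mono-≤ 1≤D 1≤θ′)

    2≤z : 2 ≤ z
    2≤z = *-mono-≤ 2≤Z 1≤θ

    1≤p : 1 ≤ p
    1≤p = subst (1 ≤_) (sym |P|≡) (*-mono-≤ (m^n>0 8 m) (*-mono-≤ (m^n>0 4 m) (≤-trans (s≤s z≤n) 2≤z)))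

    module Fw = Forward I m K t (trans |I|≡Γt (*-assoc 16 K t)) 1≤I

    phase = Fw.forward-phase m (4 ^ m * z) (*-mono-≤ (m^n>0 4 m) (≤-trans (s≤s z≤n) 2≤z)) P dense (≤-reflexive (sym |P|≡))

    Q = proj₁ phase
    Q⊆P = proj₁ (proj₂ phase)
    |Q|≥ = proj₁ (proj₂ (proj₂ phase))

    module Bw = Backward E E-pair Q (Unique-⊆ Q⊆P uniq) t L p F thr (boolLists Δ)

    -- The m forward choices gain `K ^ m = 2 ^ m * L ^ m` against at most `p ^ m` tuples in all.
    ext : Bw.Extendable m I
    ext = halve-strict {m} _ _ 1≤m (subst (_≤ p ^ m) (^-zeroˡ m) (^-monoˡ-≤ m 1≤p)) (begin
      2 ^ m * (L ^ m * Fw.badR Q)                 ≡⟨ sym (*-assoc (2 ^ m) (L ^ m) _) ⟩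
      2 ^ m * L ^ m * Fw.badR Q                   ≡⟨ cong (_* Fw.badR Q) (sym (^-distribʳ-* m 2 L)) ⟩
      K ^ m * Fw.badR Q                           ≤⟨ proj₂ (proj₂ (proj₂ phase)) ⟩
      Fw.badR P                                   ≤⟨ badTuples-≤-product Eᵒ t (replicate m P) I ⟩
      product (map length (replicate m P))        ≡⟨ product-length-replicate m P ⟩
      p ^ m                                       ∎)

    e₁ : ∀ a b z → 8 * (a * (b * z)) ≡ 8 * (a * b) * z
    e₁ = solve-∀
    e₂ : ∀ J F s θ → 8 * (J * (F * (s * θ))) ≡ 8 * (J * (F * s)) * θ
    e₂ = solve-∀

    module Lv = Bw.Levels (Bw.levels w τ z (D * θ′) (D * θ) 2≤z
      (≤-reflexive (trans (cong (8 *_) |P|≡) (e₁ (8 ^ m) (4 ^ m) z)))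
      (≤-reflexive (e₂ J F (suc Δ) θ)) Q I ⊆-refl |Q|≥ (≤-reflexive |I|≡) (≤-trans (length-mono-≤ Q⊆P) |P|≤) ext)

    large : length I ≤ Γ * length Lv.Xp′
    large = ≤-trans (≤-reflexive |I|≡Γt) (*-monoʳ-≤ Γ (<ᵇ-false {length Lv.Xp′} (indicator-<1 _ Lv.ext)))

    -- At most Δ coordinates, each ranging over up to `D` times its weight, cost `D ^ Δ`. The 2Δ
    -- choices gained `(2 * D) ^ Δ`, so `2 ^ Δ` is left for strictness.
    few-bad : ∀ {r} (ts : List Bool) → r < w → length ts ≤ Δ →
      badTuples E thr (map (select Lv.Xp′ (Lv.below r)) ts) (Lv.level r) < product (map (select θ′ θ) ts)
    few-bad {r} ts r<w ts≤ = halve-strict {Δ} b _ 1≤Δ (product-select-≥1 1≤θ′ 1≤θ ts)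
      (*-cancelˡ-≤ (D ^ Δ) {{>-nonZero (subst (_≤ D ^ Δ) (^-zeroˡ Δ) (^-monoˡ-≤ Δ 1≤D))}} (begin
        D ^ Δ * (2 ^ Δ * b)                                    ≡⟨ e₃ (D ^ Δ) (2 ^ Δ) b ⟩
        2 ^ Δ * D ^ Δ * b                                      ≡⟨ cong (_* b) (sym (^-distribʳ-* Δ 2 D)) ⟩
        (2 * D) ^ Δ * b                                        ≡⟨ cong (λ k → k ^ Δ * b) (e₄ H) ⟩
        (F ^ 2) ^ Δ * b                                        ≡⟨ cong (_* b) (^-*-assoc F 2 Δ) ⟩
        F ^ τ * b                                              ≤⟨ Lv.few-bad r<w (∈-boolLists Δ ts ts≤) ⟩
        product (map (select (D * θ′) (D * θ)) ts)             ≡⟨ product-select-scale D θ′ θ ts ⟩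
        D ^ length ts * product (map (select θ′ θ) ts)         ≤⟨ *-monoˡ-≤ _ (^-monoʳ-≤ D {{>-nonZero 1≤D}} ts≤) ⟩
        D ^ Δ * product (map (select θ′ θ) ts)                 ∎))
      where
      b = badTuples E thr (map (select Lv.Xp′ (Lv.below r)) ts) (Lv.level r)
      e₃ : ∀ d e b → d * (e * b) ≡ e * d * b
      e₃ = solve-∀
      e₄ : ∀ H → 2 * (2 * (H * H)) ≡ 2 * H * (2 * H * 1)
      e₄ = solve-∀

-- Localising a set in a short interval

⊆-++-split : (xs : List A) {ys zs : List A} → zs ⊆ xs ++ ys →
  ∃ λ zs₁ → ∃ λ zs₂ → zs ≡ zs₁ ++ zs₂ × zs₁ ⊆ xs × zs₂ ⊆ ys
⊆-++-split [] s = [] , _ , refl , [] , s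
⊆-++-split (x ∷ xs) (.x ∷ʳ s) with ⊆-++-split xs s
... | zs₁ , zs₂ , eq , s₁ , s₂ = zs₁ , zs₂ , eq , x ∷ʳ s₁ , s₂
⊆-++-split (x ∷ xs) (refl ∷ s) with ⊆-++-split xs s
... | zs₁ , zs₂ , eq , s₁ , s₂ = x ∷ zs₁ , zs₂ , cong (x ∷_) eq , refl ∷ s₁ , s₂

length-take-≤ : (k : ℕ) (xs : List A) → length (take k xs) ≤ k
length-take-≤ k xs = ≤-trans (≤-reflexive (length-take k xs)) (m⊓n≤m k _)

length-take-≡ : (k : ℕ) (xs : List A) → k ≤ length xs → length (take k xs) ≡ k
length-take-≡ k xs h = trans (length-take k xs) (m≤n⇒m⊓n≡m h)

-- Pigeonhole over k consecutive pieces. A set reserved for a block is scattered over its interval;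
-- confining it to one short piece bounds the gap to the interval taken next.
dense-segment : (k ℓ : ℕ) (J P : List A) → length J ≤ k * ℓ → P ⊆ J →
  ∃ λ J₁ → ∃ λ J′ → ∃ λ J₂ → ∃ λ P′ → J ≡ J₁ ++ J′ ++ J₂ × length J′ ≤ ℓ ×
    P′ ⊆ J′ × P′ ⊆ P × length P ≤ k * length P′
dense-segment zero ℓ [] [] _ _ = [] , [] , [] , [] , refl , z≤n , [] , [] , z≤n
dense-segment (suc k) ℓ J P h s
  with ⊆-++-split (take ℓ J) (subst (P ⊆_) (sym (take++drop≡id ℓ J)) s)
... | Pa , Pb , refl , sa , sb
  with dense-segment k ℓ (drop ℓ J) Pb (+-cancelˡ-≤ ℓ _ _ bound) sb
  where
  bound : ℓ + length (drop ℓ J) ≤ ℓ + k * ℓ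
  bound with ℓ ≤? length J
  ... | yes ℓ≤ = ≤-trans (≤-reflexive (trans (cong (_+ length (drop ℓ J)) (sym (length-take-≡ ℓ J ℓ≤)))
          (trans (sym (length-++ (take ℓ J))) (cong length (take++drop≡id ℓ J))))) h
  ... | no ℓ≰ = ≤-trans (≤-reflexive (cong (ℓ +_) (trans (length-drop ℓ J) (m≤n⇒m∸n≡0 (<⇒≤ (≰⇒> ℓ≰))))))
          (+-monoʳ-≤ ℓ z≤n)
... | J₁ , J′ , J₂ , P′ , eq , J′≤ , sJ , sP , Pb≤ with ≤-total (length P′) (length Pa)
... | inj₁ P′≤Pa = [] , take ℓ J , drop ℓ J , Pa , sym (take++drop≡id ℓ J) , length-take-≤ ℓ J , sa , ++⁺ʳ Pb ⊆-refl ,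
  ≤-trans (≤-reflexive (length-++ Pa)) (+-monoʳ-≤ (length Pa) (≤-trans Pb≤ (*-monoʳ-≤ k P′≤Pa)))
... | inj₂ Pa≤P′ = take ℓ J ++ J₁ , J′ , J₂ , P′ ,
  trans (sym (take++drop≡id ℓ J)) (trans (cong (take ℓ J ++_) eq) (sym (++-assoc (take ℓ J) J₁ _))) ,
  J′≤ , sJ , ++⁺ˡ Pa sP ,
  ≤-trans (≤-reflexive (length-++ Pa)) (+-mono-≤ Pa≤P′ Pb≤)

sumTo : (ℕ → ℕ) → ℕ → ℕ
sumTo f zero = f 0
sumTo f (suc k) = f 0 + sumTo (f ∘ suc) k

f₀≤sumTo : (f : ℕ → ℕ) (k : ℕ) → f 0 ≤ sumTo f k
f₀≤sumTo f zero = ≤-refl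
f₀≤sumTo f (suc k) = m≤m+n (f 0) _

-- Chaining the blocks

module Chain {V : Set} (E : V → V → Bool)
  (E-pair : ∀ {x y} → x ≢ y → ⟦ E x y ⟧ + ⟦ E y x ⟧ ≡ 1) (Δ w : ℕ) (1≤Δ : 1 ≤ Δ) (1≤w : 1 ≤ w) where

  open Tournaments E E-pair
  open Constants Δ w
  open Block E E-pair Δ w 1≤Δ 1≤w

  -- Blocks are numbered from the sinks upwards, so arcs enter block i from block
  -- suc i, or from a lower level r′ of block i.
  Precedes : ℕ → ℕ → ℕ → ℕ × ℕ → Set
  Precedes k i r (j , r′) = r′ < w × ((j ≡ suc i × suc i < k) ⊎ (j ≡ i × r′ < r))

  -- The median property gives `y` arcs from half of `b` and `I` together. Even if all of `b` is
  -- among these in-neighbours, a quarter of `I` must be too, as `b` is at most half as long.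
  segment-dense : (xs : List V) (y : V) (b I M : List V) → Median (xs ++ y ∷ (b ++ (I ++ M))) →
    2 * length b ≤ length I → length I ≤ 4 * indegree y I
  segment-dense xs y b I M median 2b≤I = +-cancelˡ-≤ (length I) _ _ (begin
    length I + length I                              ≡⟨ cong (length I +_) (sym (+-identityʳ _)) ⟩
    2 * length I                                     ≤⟨ *-monoʳ-≤ 2 half ⟩
    2 * (length b + 2 * indegree y I)                ≡⟨ e₁ (length b) (indegree y I) ⟩
    2 * length b + 4 * indegree y I                  ≤⟨ +-monoˡ-≤ _ 2b≤I ⟩
    length I + 4 * indegree y I                      ∎)
    where
    open ≤-Reasoning
    e₁ : ∀ b i → 2 * (b + 2 * i) ≡ 2 * b + 4 * i
    e₁ = solve-∀
    e₂ : ∀ b i → 2 * (b + i) ≡ b + (b + 2 * i)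
    e₂ = solve-∀
    after : length (b ++ I) ≤ 2 * indegree y (b ++ I)
    after = Median-half (Median-++ xs median) (b ++ I) M (sym (++-assoc b I M))
    half : length I ≤ length b + 2 * indegree y I
    half = +-cancelˡ-≤ (length b) _ _ (begin
      length b + length I                              ≡⟨ sym (length-++ b) ⟩
      length (b ++ I)                                  ≤⟨ after ⟩
      2 * indegree y (b ++ I)                          ≡⟨ cong (2 *_) (count-++ _ b I) ⟩
      2 * (indegree y b + indegree y I)                ≤⟨ *-monoʳ-≤ 2 (+-monoˡ-≤ _ (count-≤ _ b)) ⟩
      2 * (length b + indegree y I)                    ≡⟨ e₂ (length b) (indegree y I) ⟩
      length b + (length b + 2 * indegree y I)         ∎)

  BoundedTypes : (ℕ → ℕ → List V) → (ℕ → ℕ) → List V → List V → List (ℕ × ℕ) → Set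
  BoundedTypes S θ P′ low us = ∃ λ ts → length ts ≡ length us ×
    Pointwise _⊆_ (map (uncurry S) us) (map (select P′ low) ts) ×
    product (map (select (θ 1) (θ 0)) ts) ≡ product (map (θ ∘ proj₁) us)

  -- Translates the positions of in-neighbours of a vertex of block 0 into a type, so that the
  -- estimates for one block apply: block 1 becomes `true`, block 0 becomes `false`.
  bounded-types : (S : ℕ → ℕ → List V) (θ : ℕ → ℕ) (P′ low : List V) {k r : ℕ} →
    (∀ {r′} → 0 < k → r′ < w → S 1 r′ ⊆ P′) → (∀ {r′} → r′ < r → S 0 r′ ⊆ low) →
    (us : List (ℕ × ℕ)) → All (Precedes (suc k) 0 r) us → BoundedTypes S θ P′ low us
  bounded-types S θ P′ low h₁ h₀ [] [] = [] , refl , [] , refl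
  bounded-types S θ P′ low h₁ h₀ (_ ∷ us) ((r′< , inj₁ (refl , s≤s 0<k)) ∷ al)
    with bounded-types S θ P′ low h₁ h₀ us al
  ... | ts , e₁ , pw , e₂ = true ∷ ts , cong suc e₁ , h₁ 0<k r′< ∷ pw , cong (θ 1 *_) e₂
  bounded-types S θ P′ low h₁ h₀ (_ ∷ us) ((r′< , inj₂ (refl , r′<r)) ∷ al)
    with bounded-types S θ P′ low h₁ h₀ us al
  ... | ts , e₁ , pw , e₂ = false ∷ ts , cong suc e₁ , h₀ r′<r ∷ pw , cong (θ 0 *_) e₂

  Unshifted : (ℕ → ℕ → List V) → (ℕ → ℕ) → ℕ → ℕ → ℕ → List (ℕ × ℕ) → Set
  Unshifted S θ k i r us = ∃ λ us′ → length us′ ≡ length us ×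
    All (Precedes k i r) us′ × map (uncurry (S ∘ suc)) us′ ≡ map (uncurry S) us ×
    map (θ ∘ suc ∘ proj₁) us′ ≡ map (θ ∘ proj₁) us

  unshift : (S : ℕ → ℕ → List V) (θ : ℕ → ℕ) {k i r : ℕ} (us : List (ℕ × ℕ)) →
    All (Precedes (suc k) (suc i) r) us → Unshifted S θ k i r us
  unshift S θ [] [] = [] , refl , [] , refl , refl
  unshift S θ {i = i} ((_ , r′) ∷ us) ((r′< , inj₁ (refl , s≤s i<)) ∷ al) with unshift S θ us al
  ... | us′ , e₁ , al′ , e₂ , e₃ =
    (suc i , r′) ∷ us′ , cong suc e₁ , (r′< , inj₁ (refl , i<)) ∷ al′ , cong (_ ∷_) e₂ , cong (_ ∷_) e₃
  unshift S θ {i = i} ((_ , r′) ∷ us) ((r′< , inj₂ (refl , r′<r)) ∷ al) with unshift S θ us al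
  ... | us′ , e₁ , al′ , e₂ , e₃ =
    (i , r′) ∷ us′ , cong suc e₁ , (r′< , inj₂ (refl , r′<r)) ∷ al′ , cong (_ ∷_) e₂ , cong (_ ∷_) e₃

  record BlockChain (k : ℕ) (θ : ℕ → ℕ) (M P : List V) : Set where
    field
      S : ℕ → ℕ → List V
      S⊆M : ∀ {i r} → i < k → r < w → S i r ⊆ M
      S₀⊆P : ∀ {r} → 0 < k → r < w → S 0 r ⊆ P
      disjoint : ∀ {i j r r′ x} → i < k → j < k → r < w → r′ < w → i ≢ j → x ∈ S i r → x ∈ S j r′ → ⊥
      few-bad : ∀ {i r} (us : List (ℕ × ℕ)) → i < k → r < w → length us ≤ Δ → All (Precedes k i r) us →
        badTuples E (suc Δ * θ i) (map (uncurry S) us) (S i r) < product (map (θ ∘ proj₁) us)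

  Segment : (ℕ → ℕ) → List V → List V → Set
  Segment θ J P = ∃ λ J₁ → ∃ λ J′ → ∃ λ J₂ → ∃ λ P′ →
    J ≡ J₁ ++ J′ ++ J₂ × length J′ ≤ Γ * (x * Z) * θ 0 × P′ ⊆ J′ × P′ ⊆ P × length P ≤ 4 * length P′

  quarters : (t : ℕ) → D * t ≡ 4 * (Γ * (x * Z) * t)
  quarters t = trans (cong (_* t) D≡ΓR) (e Γ (x * Z) t)
    where
    e : ∀ g y t → g * (4 * y) * t ≡ 4 * (g * y * t)
    e = solve-∀

  -- `J` is the interval of the current block and `P` the part of it left over by the step before.
  -- The total runs up to `θ k`, one term beyond the k blocks, because the last block also takes an
  -- interval preceding it.
  blockChain : (k : ℕ) (θ : ℕ → ℕ) → (∀ i → 1 ≤ θ i) → (∀ i → θ i ≤ 2 * θ (suc i)) →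
    (J M P : List V) → Unique (J ++ M) → Median (J ++ M) → length J ≡ D * θ 0 →
    D * sumTo θ k ≤ length (J ++ M) → P ⊆ J → length J ≤ Γ * length P → BlockChain k θ (J ++ M) P

  blockStep : (k : ℕ) (θ : ℕ → ℕ) → (∀ i → 1 ≤ θ i) → (∀ i → θ i ≤ 2 * θ (suc i)) →
    (J M P : List V) → Unique (J ++ M) → Median (J ++ M) → length J ≡ D * θ 0 →
    D * sumTo θ (suc k) ≤ length (J ++ M) → length J ≤ Γ * length P → Segment θ J P →
    BlockChain (suc k) θ (J ++ M) P

  blockChain zero θ _ _ J M P _ _ _ _ _ _ = record
    { S = λ _ _ → [] ; S⊆M = λ () ; S₀⊆P = λ () ; disjoint = λ () ; few-bad = λ _ () }
  blockChain (suc k) θ 1≤θ ratio J M P uniq median |J|≡ total≤ P⊆J J≤ =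
    blockStep k θ 1≤θ ratio J M P uniq median |J|≡ total≤ J≤
      (dense-segment 4 (Γ * (x * Z) * θ 0) J P (≤-reflexive (trans |J|≡ (quarters (θ 0)))) P⊆J)

  blockStep k θ 1≤θ ratio _ M P uniq median |J|≡ total≤ J≤ (J₁ , J′ , J₂ , P₁ , refl , J′≤ , P₁⊆J′ , P₁⊆P , P≤) = record
    { S = S ; S⊆M = S⊆M ; S₀⊆P = S₀⊆P ; disjoint = disjoint ; few-bad = few-bad }
    where
    open ≤-Reasoning
    ℓ = Γ * (x * Z) * θ 0
    M₂ = J₂ ++ M
    -- The new interval starts right after `J′`, inside the remainder `J₂` of the old one, so fewer
    -- than `ℓ` vertices separate it from any vertex of `J′`.
    I = take (D * θ 1) M₂
    M₃ = drop (D * θ 1) M₂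
    q = 8 ^ m * (4 ^ m * (Z * θ 0))
    P₂ = take q P₁

    4ℓ≡ : 4 * ℓ ≡ D * θ 0
    4ℓ≡ = sym (quarters (θ 0))

    M≡ : (J₁ ++ J′ ++ J₂) ++ M ≡ (J₁ ++ J′) ++ M₂
    M≡ = trans (cong (_++ M) (sym (++-assoc J₁ J′ J₂))) (++-assoc (J₁ ++ J′) J₂ M)

    uniq′ : Unique ((J₁ ++ J′) ++ M₂)
    uniq′ = subst Unique M≡ uniq

    median′ : Median ((J₁ ++ J′) ++ M₂)
    median′ = subst Median M≡ median

    M₂≡ : I ++ M₃ ≡ M₂
    M₂≡ = take++drop≡id (D * θ 1) M₂

    enough : D * sumTo (θ ∘ suc) k ≤ length M₂
    enough = +-cancelˡ-≤ (D * θ 0) _ _ (begin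
      D * θ 0 + D * sumTo (θ ∘ suc) k         ≡⟨ sym (*-distribˡ-+ D (θ 0) _) ⟩
      D * sumTo θ (suc k)                     ≤⟨ total≤ ⟩
      length ((J₁ ++ J′ ++ J₂) ++ M)          ≡⟨ length-++ (J₁ ++ J′ ++ J₂) ⟩
      length (J₁ ++ J′ ++ J₂) + length M      ≡⟨ cong (_+ length M) |J|≡ ⟩
      D * θ 0 + length M                      ≤⟨ +-monoʳ-≤ (D * θ 0) (≤-trans (m≤n+m _ (length J₂)) (≤-reflexive (sym (length-++ J₂)))) ⟩
      D * θ 0 + length M₂                     ∎)

    |I|≡ : length I ≡ D * θ 1
    |I|≡ = length-take-≡ (D * θ 1) M₂ (≤-trans (*-monoʳ-≤ D (f₀≤sumTo (θ ∘ suc) k)) enough)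

    -- `P` has a 1/Γ share of the interval and `P₁` a quarter of `P`, so at least `R * θ 0` over 4,
    -- which is `q`.
    |P₂|≡ : length P₂ ≡ q
    |P₂|≡ = length-take-≡ q P₁ (*-cancelˡ-≤ (4 * Γ) {{>-nonZero (*-mono-≤ {1} {4} (s≤s z≤n) (*-mono-≤ {1} {16} (s≤s z≤n)
        (*-mono-≤ {1} {2} (s≤s z≤n) (*-mono-≤ {1} {8} (s≤s z≤n) 1≤x))))}} (begin
      4 * Γ * q                                       ≡⟨ e Γ (8 ^ m) (4 ^ m) Z (θ 0) ⟩
      4 * ℓ                                           ≡⟨ trans 4ℓ≡ (sym |J|≡) ⟩
      length (J₁ ++ J′ ++ J₂)                         ≤⟨ J≤ ⟩
      Γ * length P                                    ≤⟨ *-monoʳ-≤ Γ P≤ ⟩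
      Γ * (4 * length P₁)                             ≡⟨ e′ Γ (length P₁) ⟩
      4 * Γ * length P₁                               ∎))
      where
      e : ∀ g a b z t → 4 * g * (a * (b * (z * t))) ≡ 4 * (g * (a * b * z) * t)
      e = solve-∀
      e′ : ∀ g p → g * (4 * p) ≡ 4 * g * p
      e′ = solve-∀

    P₂⊆P₁ : P₂ ⊆ P₁
    P₂⊆P₁ = take-⊆ q P₁

    P₂⊆ : P₂ ⊆ J₁ ++ J′
    P₂⊆ = ⊆-trans P₂⊆P₁ (++⁺ˡ J₁ P₁⊆J′)

    |P₂|≤ : length P₂ ≤ D * θ 0
    |P₂|≤ = begin
      length P₂         ≤⟨ length-mono-≤ (⊆-trans P₂⊆P₁ P₁⊆J′) ⟩
      length J′         ≤⟨ J′≤ ⟩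
      ℓ                 ≤⟨ m≤m+n ℓ _ ⟩
      4 * ℓ             ≡⟨ 4ℓ≡ ⟩
      D * θ 0           ∎

    -- Here the slow decrease of the sizes matters: `ℓ` is a quarter of `D * θ 0`, hence at most
    -- half of `D * θ 1`.
    2ℓ≤I : 2 * ℓ ≤ length I
    2ℓ≤I = *-cancelˡ-≤ 2 (begin
      2 * (2 * ℓ)               ≡⟨ sym (*-assoc 2 2 ℓ) ⟩
      4 * ℓ                     ≡⟨ 4ℓ≡ ⟩
      D * θ 0                   ≤⟨ *-monoʳ-≤ D (ratio 0) ⟩
      D * (2 * θ 1)             ≡⟨ e D (θ 1) ⟩
      2 * (D * θ 1)             ≡⟨ cong (2 *_) (sym |I|≡) ⟩
      2 * length I              ∎)
      where
      e : ∀ d t → d * (2 * t) ≡ 2 * (d * t)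
      e = solve-∀

    dense : ∀ {y} → y ∈ P₂ → length I ≤ 4 * indegree y I
    dense {y} y∈ = from-split (∈-∃++ (lookup (⊆-trans P₂⊆P₁ P₁⊆J′) y∈))
      where
      from-split : (∃ λ a → ∃ λ b → J′ ≡ a ++ y ∷ b) → length I ≤ 4 * indegree y I
      from-split (a , b , eq) = segment-dense (J₁ ++ a) y b I M₃ (subst Median shape median′)
        (≤-trans (*-monoʳ-≤ 2 b≤ℓ) 2ℓ≤I)
        where
        b≤ℓ : length b ≤ ℓ
        b≤ℓ = ≤-trans (≤-trans (≤-trans (n≤1+n _) (m≤n+m _ (length a)))
          (≤-reflexive (trans (sym (length-++ a)) (cong length (sym eq))))) J′≤
        shape : (J₁ ++ J′) ++ M₂ ≡ (J₁ ++ a) ++ y ∷ (b ++ (I ++ M₃))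
        shape = trans (cong₂ _++_ (trans (cong (J₁ ++_) eq) (sym (++-assoc J₁ a (y ∷ b)))) (sym M₂≡))
          (++-assoc (J₁ ++ a) (y ∷ b) (I ++ M₃))

    module B = BlockLevels (blockLevels P₂ I (θ 0) (θ 1) (1≤θ 0) (1≤θ 1)
      (Unique-⊆ (⊆-trans P₂⊆ (++⁺ʳ M₂ ⊆-refl)) uniq′) |P₂|≡ |P₂|≤ |I|≡ dense)

    rest : BlockChain k (θ ∘ suc) (I ++ M₃) B.P′
    rest = blockChain k (θ ∘ suc) (1≤θ ∘ suc) (ratio ∘ suc) I M₃ B.P′
      (subst Unique (sym M₂≡) (Unique-⊆ (++⁺ˡ (J₁ ++ J′) ⊆-refl) uniq′))
      (subst Median (sym M₂≡) (Median-++ (J₁ ++ J′) median′)) |I|≡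
      (≤-trans enough (≤-reflexive (cong length (sym M₂≡)))) B.P′⊆ B.large

    module C = BlockChain rest

    S : ℕ → ℕ → List V
    S zero = B.level
    S (suc i) = C.S i

    S-suc⊆M₂ : ∀ {i r} → i < k → r < w → C.S i r ⊆ M₂
    S-suc⊆M₂ {i} {r} i< r< = subst (C.S i r ⊆_) M₂≡ (C.S⊆M i< r<)

    S⊆M : ∀ {i r} → i < suc k → r < w → S i r ⊆ (J₁ ++ J′ ++ J₂) ++ M
    S⊆M {zero} _ r< = subst (B.level _ ⊆_) (sym M≡) (⊆-trans (B.level⊆ r<) (⊆-trans P₂⊆ (++⁺ʳ M₂ ⊆-refl)))
    S⊆M {suc i} (s≤s i<) r< = subst (C.S i _ ⊆_) (sym M≡) (++⁺ˡ (J₁ ++ J′) (S-suc⊆M₂ i< r<))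

    S₀⊆P : ∀ {r} → 0 < suc k → r < w → S 0 r ⊆ P
    S₀⊆P _ r< = ⊆-trans (B.level⊆ r<) (⊆-trans P₂⊆P₁ P₁⊆P)

    apart : ∀ {j r r′ y} → j < k → r < w → r′ < w → y ∈ S 0 r → y ∈ C.S j r′ → ⊥
    apart j< r< r′< y∈ y∈′ = Unique-++-∉ (J₁ ++ J′) uniq′
      (lookup P₂⊆ (lookup (B.level⊆ r<) y∈)) (lookup (S-suc⊆M₂ j< r′<) y∈′)

    disjoint : ∀ {i j r r′ y} → i < suc k → j < suc k → r < w → r′ < w → i ≢ j → y ∈ S i r → y ∈ S j r′ → ⊥
    disjoint {zero} {zero} _ _ _ _ i≢j _ _ = i≢j refl
    disjoint {zero} {suc j} _ (s≤s j<) r< r′< _ y∈ y∈′ = apart j< r< r′< y∈ y∈′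
    disjoint {suc i} {zero} (s≤s i<) _ r< r′< _ y∈ y∈′ = apart i< r′< r< y∈′ y∈
    disjoint {suc i} {suc j} (s≤s i<) (s≤s j<) r< r′< i≢j y∈ y∈′ = C.disjoint i< j< r< r′< (i≢j ∘ cong suc) y∈ y∈′

    few-bad : ∀ {i r} (us : List (ℕ × ℕ)) → i < suc k → r < w → length us ≤ Δ → All (Precedes (suc k) i r) us →
      badTuples E (suc Δ * θ i) (map (uncurry S) us) (S i r) < product (map (θ ∘ proj₁) us)
    few-bad {zero} {r} us _ r< len al =
      first (bounded-types S θ B.P′ (B.below r) {k} {r} C.S₀⊆P (B.level⊆below r<) us al)
      where
      first : BoundedTypes S θ B.P′ (B.below r) us →
        badTuples E (suc Δ * θ 0) (map (uncurry S) us) (B.level r) < product (map (θ ∘ proj₁) us)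
      first (ts , e₁ , pw , e₂) = subst (badTuples E (suc Δ * θ 0) (map (uncurry S) us) (B.level r) <_) e₂
        (≤-<-trans (badTuples-mono E (suc Δ * θ 0) pw (B.level r))
          (B.few-bad ts r< (≤-trans (≤-reflexive e₁) len)))
    few-bad {suc i} {r} us (s≤s i<) r< len al = later (unshift S θ us al)
      where
      later : Unshifted S θ k i r us →
        badTuples E (suc Δ * θ (suc i)) (map (uncurry S) us) (C.S i r) < product (map (θ ∘ proj₁) us)
      later (us′ , e₁ , al′ , e₂ , e₃) = subst₂ (λ l k → badTuples E (suc Δ * θ (suc i)) l (C.S i r) < product k) e₂ e₃
        (C.few-bad us′ i< r< (≤-trans (≤-reflexive e₁) len) al′)

-- Block sizes and their smoothing

sumTo-snoc : (f : ℕ → ℕ) (k : ℕ) → sumTo f (suc k) ≡ sumTo f k + f (suc k)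
sumTo-snoc f zero = refl
sumTo-snoc f (suc k) = trans (cong (f 0 +_) (sumTo-snoc (f ∘ suc) k)) (sym (+-assoc (f 0) _ _))

sumTo-mono : {f g : ℕ → ℕ} → (∀ i → f i ≤ g i) → ∀ k → sumTo f k ≤ sumTo g k
sumTo-mono h zero = h 0
sumTo-mono h (suc k) = +-mono-≤ (h 0) (sumTo-mono (h ∘ suc) k)

sumTo-suc : (f : ℕ → ℕ) (k : ℕ) → sumTo (suc ∘ f) k ≡ suc k + sumTo f k
sumTo-suc f zero = refl
sumTo-suc f (suc k) = cong suc (trans (cong (f 0 +_) (sumTo-suc (f ∘ suc) k)) (swap (f 0) (suc k) (sumTo (f ∘ suc) k)))
  where
  swap : ∀ a b c → a + (b + c) ≡ b + (a + c)
  swap = solve-∀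

sumTo-count-≤ : (f : A → ℕ) (xs : List A) (k : ℕ) →
  sumTo (λ i → count (λ v → f v ≡ᵇ i) xs) k ≤ count (λ v → f v <ᵇ suc k) xs
sumTo-count-≤ f xs k = prefix k
  where
  step : ∀ a j → ⟦ a <ᵇ j ⟧ + ⟦ a ≡ᵇ j ⟧ ≤ ⟦ a <ᵇ suc j ⟧
  step zero zero = ≤-refl
  step zero (suc j) = ≤-refl
  step (suc a) zero = z≤n
  step (suc a) (suc j) = step a j
  count-step : ∀ j → count (λ v → f v <ᵇ j) xs + count (λ v → f v ≡ᵇ j) xs ≤ count (λ v → f v <ᵇ suc j) xs
  count-step j = ≤-trans
    (≤-reflexive (trans (cong₂ _+_ (count-∑ (λ v → f v <ᵇ j) xs) (count-∑ (λ v → f v ≡ᵇ j) xs))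
      (sym (∑-+ xs (λ v → ⟦ f v <ᵇ j ⟧) (λ v → ⟦ f v ≡ᵇ j ⟧)))))
    (≤-trans (∑-mono xs (λ v → step (f v) j)) (≤-reflexive (sym (count-∑ (λ v → f v <ᵇ suc j) xs))))
  prefix : ∀ j → sumTo (λ i → count (λ v → f v ≡ᵇ i) xs) j ≤ count (λ v → f v <ᵇ suc j) xs
  prefix zero = ≤-trans (m≤n+m _ _) (count-step 0)
  prefix (suc j) = ≤-trans (≤-reflexive (sumTo-snoc _ j))
    (≤-trans (+-monoˡ-≤ _ (prefix j)) (count-step (suc j)))

n≤1+2⌊n/2⌋ : ∀ n → n ≤ suc (2 * ⌊ n /2⌋)
n≤1+2⌊n/2⌋ zero = z≤n
n≤1+2⌊n/2⌋ (suc zero) = s≤s z≤n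
n≤1+2⌊n/2⌋ (suc (suc n)) = ≤-trans (s≤s (s≤s (n≤1+2⌊n/2⌋ n))) (≤-reflexive (e ⌊ n /2⌋))
  where
  e : ∀ k → suc (suc (suc (2 * k))) ≡ suc (2 * suc k)
  e = solve-∀

2⌊n/2⌋≤n : ∀ n → 2 * ⌊ n /2⌋ ≤ n
2⌊n/2⌋≤n zero = z≤n
2⌊n/2⌋≤n (suc zero) = z≤n
2⌊n/2⌋≤n (suc (suc n)) = ≤-trans (≤-reflexive (e ⌊ n /2⌋)) (s≤s (s≤s (2⌊n/2⌋≤n n)))
  where
  e : ∀ k → 2 * suc k ≡ suc (suc (2 * k))
  e = solve-∀

-- A majorant of b that never drops by more than a factor of 2, while its total is at most
-- twice that of suc ∘ b.
smooth : (ℕ → ℕ) → ℕ → ℕ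
smooth b zero = suc (b 0)
smooth b (suc i) = suc (b (suc i)) + ⌊ smooth b i /2⌋

smooth-≥1 : ∀ b i → 1 ≤ smooth b i
smooth-≥1 b zero = s≤s z≤n
smooth-≥1 b (suc i) = s≤s z≤n

smooth-≥ : ∀ b i → b i ≤ smooth b i
smooth-≥ b zero = n≤1+n _
smooth-≥ b (suc i) = ≤-trans (n≤1+n _) (m≤m+n _ _)

smooth-ratio : ∀ b i → smooth b i ≤ 2 * smooth b (suc i)
smooth-ratio b i = ≤-trans (n≤1+2⌊n/2⌋ (smooth b i)) (≤-trans (m≤n+m _ (suc (2 * b (suc i)))) (≤-reflexive (e (b (suc i)) ⌊ smooth b i /2⌋)))
  where
  e : ∀ c k → suc (2 * c) + suc (2 * k) ≡ 2 * (suc c + k)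
  e = solve-∀

sumTo-smooth : ∀ b k → sumTo (smooth b) k ≤ 2 * sumTo (suc ∘ b) k
sumTo-smooth b k = ≤-trans (m≤m+n _ (smooth b k)) (strong k)
  where
  open ≤-Reasoning
  -- Counting the last term twice makes the induction work: twice what it hands on to the next term
  -- is at most itself.
  strong : ∀ k → sumTo (smooth b) k + smooth b k ≤ 2 * sumTo (suc ∘ b) k
  strong zero = ≤-reflexive (cong (smooth b 0 +_) (sym (+-identityʳ _)))
  strong (suc k) = begin
    sumTo (smooth b) (suc k) + smooth b (suc k)     ≡⟨ cong (_+ smooth b (suc k)) (sumTo-snoc (smooth b) k) ⟩
    t + smooth b (suc k) + smooth b (suc k)         ≡⟨ e t (suc (b (suc k))) ⌊ smooth b k /2⌋ ⟩
    t + 2 * ⌊ smooth b k /2⌋ + 2 * suc (b (suc k))  ≤⟨ +-monoˡ-≤ _ (≤-trans (+-monoʳ-≤ t (2⌊n/2⌋≤n (smooth b k))) (strong k)) ⟩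
    2 * sumTo (suc ∘ b) k + 2 * suc (b (suc k))     ≡⟨ sym (*-distribˡ-+ 2 (sumTo (suc ∘ b) k) _) ⟩
    2 * (sumTo (suc ∘ b) k + suc (b (suc k)))       ≡⟨ cong (2 *_) (sym (sumTo-snoc (suc ∘ b) k)) ⟩
    2 * sumTo (suc ∘ b) (suc k)                     ∎
    where
    t = sumTo (smooth b) k
    e : ∀ s c h → s + (c + h) + (c + h) ≡ s + 2 * h + 2 * c
    e = solve-∀

-- The numerical bound behind the exponent 57

suc≤2^ : ∀ k → suc k ≤ 2 ^ k
suc≤2^ zero = ≤-refl
suc≤2^ (suc k) = ≤-trans (+-mono-≤ (m^n>0 2 k) (suc≤2^ k)) (≤-reflexive (cong (2 ^ k +_) (sym (+-identityʳ _))))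

collect-powers : ∀ a → 2 * (2 ^ a * 2 ^ a) * 8 ≡ 2 ^ (4 + (a + a))
collect-powers a = trans (e (2 ^ a * 2 ^ a))
  (trans (cong (16 *_) (sym (^-distribˡ-+-* 2 a a))) (sym (^-distribˡ-+-* 2 4 (a + a))))
  where
  e : ∀ y → 2 * y * 8 ≡ 16 * y
  e = solve-∀

module _ (Δ w : ℕ) (1≤Δ : 1 ≤ Δ) (1≤w : 1 ≤ w) where

  open Constants Δ w

  H≤ : H ≤ 2 ^ (14 + 10 * m + 2 * Δ)
  H≤ = begin
    scale * (x * x) * (J * suc Δ)
      ≤⟨ *-monoʳ-≤ (scale * (x * x)) (*-mono-≤ (≤-trans (n≤1+n J) (≤-reflexive (length-boolLists Δ))) (suc≤2^ Δ)) ⟩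
    scale * (x * x) * (2 ^ suc Δ * 2 ^ Δ)
      ≡⟨ cong (_* (2 ^ suc Δ * 2 ^ Δ)) (cong₂ _*_ scale≡ (cong₂ _*_ x≡ x≡)) ⟩
    2 ^ 13 * (2 ^ (5 * m) * 2 ^ (5 * m)) * (2 ^ suc Δ * 2 ^ Δ)
      ≡⟨ cong₂ _*_ (trans (cong (2 ^ 13 *_) (sym (^-distribˡ-+-* 2 (5 * m) (5 * m)))) (sym (^-distribˡ-+-* 2 13 (5 * m + 5 * m))))
           (sym (^-distribˡ-+-* 2 (suc Δ) Δ)) ⟩
    2 ^ (13 + (5 * m + 5 * m)) * 2 ^ (suc Δ + Δ)
      ≡⟨ sym (^-distribˡ-+-* 2 (13 + (5 * m + 5 * m)) (suc Δ + Δ)) ⟩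
    2 ^ (13 + (5 * m + 5 * m) + (suc Δ + Δ))
      ≡⟨ cong (2 ^_) (e m Δ) ⟩
    2 ^ (14 + 10 * m + 2 * Δ) ∎
    where
    open ≤-Reasoning
    x≡ : x ≡ 2 ^ (5 * m)
    x≡ = trans (cong₂ _*_ (^-*-assoc 2 3 m) (^-*-assoc 2 2 m))
      (trans (sym (^-distribˡ-+-* 2 (3 * m) (2 * m))) (cong (2 ^_) (sym (*-distribʳ-+ m 3 2))))
    e : ∀ m d → 13 + (5 * m + 5 * m) + (suc d + d) ≡ 14 + 10 * m + 2 * d
    e = solve-∀

  -- With m = 2Δw the exponent of 2 is 32 + 4Δ + 40Δw, at most 76Δw as Δ and w are positive, and
  -- 2^76 = 16^19 is at most 27^19 = 3^57. The leading 40Δw arises because `D` grows like the fourth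
  -- power of `x`, which is 32^m. The factor 6 is the cost of smoothing.
  D*6≤ : D * 6 ≤ 3 ^ (57 * Δ * w)
  D*6≤ = begin
    2 * (H * H) * 6                              ≤⟨ *-mono-≤ (*-monoʳ-≤ 2 (*-mono-≤ H≤ H≤)) (m≤m+n 6 2) ⟩
    2 * (2 ^ a * 2 ^ a) * 8                      ≡⟨ collect-powers a ⟩
    2 ^ (4 + (a + a))                            ≤⟨ ^-monoʳ-≤ 2 exponent ⟩
    2 ^ (4 * (19 * (Δ * w)))                     ≡⟨ sym (^-*-assoc 2 4 (19 * (Δ * w))) ⟩
    16 ^ (19 * (Δ * w))                          ≤⟨ ^-monoˡ-≤ (19 * (Δ * w)) (m≤m+n 16 11) ⟩
    27 ^ (19 * (Δ * w))                          ≡⟨ ^-*-assoc 3 3 (19 * (Δ * w)) ⟩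
    3 ^ (3 * (19 * (Δ * w)))                     ≡⟨ cong (3 ^_) (e₁ Δ w) ⟩
    3 ^ (57 * Δ * w) ∎
    where
    open ≤-Reasoning
    a = 14 + 10 * m + 2 * Δ
    e₁ : ∀ d w → 3 * (19 * (d * w)) ≡ 57 * d * w
    e₁ d w = trans (sym (*-assoc 3 19 (d * w))) (sym (*-assoc 57 d w))
    e₂ : ∀ d w → 4 + (14 + 10 * (w * (2 * d)) + 2 * d + (14 + 10 * (w * (2 * d)) + 2 * d)) ≡ 32 * 1 + 4 * (d * 1) + 40 * (d * w)
    e₂ = solve-∀
    e₃ : ∀ k → 32 * k + 4 * k + 40 * k ≡ 4 * (19 * k)
    e₃ k = trans (cong (_+ 40 * k) (sym (*-distribʳ-+ k 32 4)))
      (trans (sym (*-distribʳ-+ k 36 40)) (*-assoc 4 19 k))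
    exponent : 4 + (a + a) ≤ 4 * (19 * (Δ * w))
    exponent = begin
      4 + (a + a)                                      ≡⟨ e₂ Δ w ⟩
      32 * 1 + 4 * (Δ * 1) + 40 * (Δ * w)              ≤⟨ +-monoˡ-≤ (40 * (Δ * w)) (+-mono-≤ (*-monoʳ-≤ 32 (*-mono-≤ 1≤Δ 1≤w)) (*-monoʳ-≤ 4 (*-monoʳ-≤ Δ 1≤w))) ⟩
      32 * (Δ * w) + 4 * (Δ * w) + 40 * (Δ * w)        ≡⟨ e₃ (Δ * w) ⟩
      4 * (19 * (Δ * w))                               ∎

-- Levels are grouped into blocks of w consecutive levels; dropping the empty blocks
-- bounds their number by the number of vertices.
module Compress {U : Set} (arc : U → U → Bool) (vertices : List U) (complete : ∀ u → u ∈ vertices)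
  (w : ℕ) {{_ : NonZero w}} (lv : U → ℕ)
  (graded : ∀ u v → arc u v ≡ true → lv u < lv v × lv v ≤ lv u + w) where

  n : ℕ
  n = length vertices

  quot : U → ℕ
  quot v = lv v / w

  res : U → ℕ
  res v = lv v % w

  population : ℕ → ℕ
  population i = count (λ v → quot v ≡ᵇ i) vertices

  occupied : ℕ → ℕ
  occupied i = 1 ⊓ population i

  rank : ℕ → ℕ
  rank zero = 0
  rank (suc j) = sumTo occupied j

  rank-suc : ∀ j → rank (suc j) ≡ rank j + occupied j
  rank-suc zero = refl
  rank-suc (suc j) = sumTo-snoc occupied j

  rank≤n : ∀ j → rank (suc j) ≤ n
  rank≤n j = ≤-trans (sumTo-mono (λ i → m⊓n≤n 1 (population i)) j)
    (≤-trans (sumTo-count-≤ quot vertices j) (count-≤ _ vertices))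

  occupied-quot : ∀ v → occupied (quot v) ≡ 1
  occupied-quot v = m≤n⇒m⊓n≡m (nonempty (∈-filterᵇ⁺ (λ u → quot u ≡ᵇ quot v) (complete v) (T⇒≡ (≡⇒≡ᵇ (quot v) (quot v) refl))))
    where
    nonempty : {B : Set} {x : B} {xs : List B} → x ∈ xs → 1 ≤ length xs
    nonempty {xs = _ ∷ _} _ = s≤s z≤n

  rank-next : ∀ v → rank (suc (quot v)) ≡ suc (rank (quot v))
  rank-next v = trans (rank-suc (quot v)) (trans (cong (rank (quot v) +_) (occupied-quot v)) (+-comm (rank (quot v)) 1))

  suc-rank≤n : ∀ v → suc (rank (quot v)) ≤ n
  suc-rank≤n v = ≤-trans (≤-reflexive (sym (rank-next v))) (rank≤n (quot v))

  -- Ranks increase along arcs while blocks are numbered from the sinks, hence the reversal.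
  blk : U → ℕ
  blk v = n ∸ suc (rank (quot v))

  blk<n : ∀ v → blk v < n
  blk<n v = ≤-trans (s≤s (m≤m+n (blk v) (rank (quot v))))
    (≤-reflexive (trans (sym (+-suc (blk v) _)) (m∸n+n≡m (suc-rank≤n v))))

  -- An arc spans at most w levels, so the quotient grows by at most one. If it grows, the block of
  -- `u` is occupied by `u`, so the rank grows by exactly one as well.
  arc-blocks : ∀ u v → arc u v ≡ true → (blk u ≡ suc (blk v)) ⊎ (blk u ≡ blk v × res u < res v)
  arc-blocks u v a with m≤n⇒m<n∨m≡n (/-monoˡ-≤ w (<⇒≤ (proj₁ (graded u v a))))
  ... | inj₂ same = inj₂ (cong (λ k → n ∸ suc (rank k)) same , +-cancelʳ-< (quot u * w) _ _ (begin-strict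
    res u + quot u * w   ≡⟨ sym (m≡m%n+[m/n]*n (lv u) w) ⟩
    lv u                 <⟨ proj₁ (graded u v a) ⟩
    lv v                 ≡⟨ m≡m%n+[m/n]*n (lv v) w ⟩
    res v + quot v * w   ≡⟨ cong (λ k → res v + k * w) (sym same) ⟩
    res v + quot u * w   ∎))
    where open ≤-Reasoning
  ... | inj₁ next = inj₁ (trans (+-∸-assoc 1 {n} {suc (suc (rank (quot u)))} suc-suc≤) (cong (λ k → suc (n ∸ suc k)) (sym rank-v)))
    where
    quot-v : quot v ≡ suc (quot u)
    quot-v = ≤-antisym (≤-trans (/-monoˡ-≤ w (proj₂ (graded u v a)))
      (≤-reflexive (trans (m/n≡1+[m∸n]/n (m≤n+m w (lv u))) (cong (λ k → suc (k / w)) (m+n∸n≡m (lv u) w))))) next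
    rank-v : rank (quot v) ≡ suc (rank (quot u))
    rank-v = trans (cong rank quot-v) (rank-next u)
    suc-suc≤ : suc (suc (rank (quot u))) ≤ n
    suc-suc≤ = subst (λ k → suc k ≤ n) rank-v (suc-rank≤n v)

-- Assembling the embedding of G

foldr-⊔-≥ : (f : A → ℕ) {x : A} {xs : List A} → x ∈ xs → f x ≤ foldr _⊔_ 0 (map f xs)
foldr-⊔-≥ f {xs = y ∷ ys} (here refl) = m≤m⊔n (f y) _
foldr-⊔-≥ f {xs = y ∷ ys} (there m) = ≤-trans (foldr-⊔-≥ f m) (m≤n⊔m (f y) _)

module Degrees {n : ℕ} (G : Digraph n) where

  degree-≤ : ∀ v → degree G v ≤ maxDegree G
  degree-≤ v = foldr-⊔-≥ (degree G) (∈-allFin v)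

  indegree-≤ : ∀ v → count (λ u → arc G u v) (allFin n) ≤ maxDegree G
  indegree-≤ v = ≤-trans (≤-reflexive (count-∑ (λ u → arc G u v) (allFin n)))
    (≤-trans (∑-mono (allFin n) (λ u → left (arc G u v) (arc G v u))) (degree-≤ v))
    where
    left : ∀ a b → ⟦ a ⟧ ≤ ⟦ a ∨ b ⟧
    left true b = ≤-refl
    left false b = z≤n

  outdegree-≤ : ∀ u → count (arc G u) (allFin n) ≤ maxDegree G
  outdegree-≤ u = ≤-trans (≤-reflexive (count-∑ (arc G u) (allFin n)))
    (≤-trans (∑-mono (allFin n) (λ v → right (arc G v u) (arc G u v))) (degree-≤ u))
    where
    right : ∀ a b → ⟦ b ⟧ ≤ ⟦ a ∨ b ⟧
    right true b = ⟦⟧≤1 b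
    right false b = ≤-refl

  maxDegree-≥1 : ∀ {u v} → arc G u v ≡ true → 1 ≤ maxDegree G
  maxDegree-≥1 {u} {v} a = ≤-trans (nonempty (∈-filterᵇ⁺ (λ u → arc G u v) (∈-allFin u) a)) (indegree-≤ v)
    where
    nonempty : {x : Fin n} {xs : List (Fin n)} → x ∈ xs → 1 ≤ length xs
    nonempty {xs = _ ∷ _} _ = s≤s z≤n

module Containment {n N : ℕ} (G : Digraph n) (T : Tournament N) (w : ℕ) (1≤w : 1 ≤ w) (1≤Δ : 1 ≤ maxDegree G)
  (1≤n : 1 ≤ n) (lv : Fin n → ℕ) (graded : ∀ u v → arc G u v ≡ true → lv u < lv v × lv v ≤ lv u + w)
  (N≥ : Constants.D (maxDegree G) w * (6 * n) ≤ N) where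

  Δ : ℕ
  Δ = maxDegree G

  E : Fin N → Fin N → Bool
  E = beats T

  E-pair : ∀ {x y} → x ≢ y → ⟦ E x y ⟧ + ⟦ E y x ⟧ ≡ 1
  E-pair {x} {y} x≢y with total T x y x≢y
  ... | inj₁ e = cong₂ _+_ (cong ⟦_⟧ e) (cong ⟦_⟧ (antisym T x y e))
  ... | inj₂ e = cong₂ _+_ (cong ⟦_⟧ (antisym T y x e)) (cong ⟦_⟧ e)

  open Constants Δ w using (D; Γ)
  open Tournaments E E-pair
  open Degrees G

  instance
    w-nonZero : NonZero w
    w-nonZero = >-nonZero 1≤w

  module Cp = Compress (arc G) (allFin n) ∈-allFin w lv graded
  open Cp using (blk; res)

  |allFin|≡ : ∀ k → length (allFin k) ≡ k
  |allFin|≡ k = length-tabulate id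

  population : ℕ → ℕ
  population i = count (λ u → blk u ≡ᵇ i) (allFin n)

  θ : ℕ → ℕ
  θ = smooth population

  -- With empty blocks dropped, indices up to n suffice, so the additive 1 in each smoothed size
  -- costs n + 1, at most 2n. The sizes themselves add n, and smoothing doubles the total.
  sumTo-θ : sumTo θ n ≤ 6 * n
  sumTo-θ = begin
    sumTo θ n                          ≤⟨ sumTo-smooth population n ⟩
    2 * sumTo (suc ∘ population) n     ≡⟨ cong (2 *_) (sumTo-suc population n) ⟩
    2 * (suc n + sumTo population n)   ≤⟨ *-monoʳ-≤ 2 (+-mono-≤ (+-monoˡ-≤ n 1≤n) (≤-trans (sumTo-count-≤ blk (allFin n) n)
                                            (≤-trans (count-≤ _ (allFin n)) (≤-reflexive (|allFin|≡ n))))) ⟩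
    2 * (n + n + n)                    ≡⟨ e n ⟩
    6 * n                              ∎
    where
    open ≤-Reasoning
    e : ∀ n → 2 * (n + n + n) ≡ 6 * n
    e = solve-∀

  ordering = medianOrder (allFin N) (allFin⁺ N)

  M : List (Fin N)
  M = proj₁ ordering

  |M|≡ : length M ≡ N
  |M|≡ = trans (↭-length (proj₁ (proj₂ ordering))) (|allFin|≡ N)

  J : List (Fin N)
  J = take (D * θ 0) M

  J++≡ : J ++ drop (D * θ 0) M ≡ M
  J++≡ = take++drop≡id (D * θ 0) M

  enough : D * sumTo θ n ≤ length M
  enough = ≤-trans (*-monoʳ-≤ D sumTo-θ) (≤-trans N≥ (≤-reflexive (sym |M|≡)))

  1≤Γ : 1 ≤ Γ
  1≤Γ = *-mono-≤ {1} {16} (s≤s z≤n) (*-mono-≤ {1} {2} (s≤s z≤n) (*-mono-≤ {1} {8} (s≤s z≤n) (Constants.1≤x Δ w)))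

  M-unique : Unique (J ++ drop (D * θ 0) M)
  M-unique = subst Unique (sym J++≡) (Unique-↭ (↭-sym (proj₁ (proj₂ ordering))) (allFin⁺ N))

  -- The block of the last sinks has no block after it to restrict its candidates, so its whole
  -- interval `J` is passed as reserved set.
  module Ch = Chain.BlockChain (Chain.blockChain E E-pair Δ w 1≤Δ 1≤w n θ (smooth-≥1 population) (smooth-ratio population)
    J (drop (D * θ 0) M) J M-unique (subst Median (sym J++≡) (proj₂ (proj₂ ordering)))
    (length-take-≡ (D * θ 0) M (≤-trans (*-monoʳ-≤ D (f₀≤sumTo θ n)) enough))
    (≤-trans enough (≤-reflexive (cong length (sym J++≡)))) ⊆-refl
    (≤-trans (≤-reflexive (sym (*-identityˡ (length J)))) (*-monoˡ-≤ (length J) 1≤Γ)))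

  blk<n : ∀ v → blk v < n
  blk<n v = subst (blk v <_) (|allFin|≡ n) (Cp.blk<n v)

  res<w : ∀ v → res v < w
  res<w v = m%n<n (lv v) w

  S : Fin n → List (Fin N)
  S v = Ch.S (blk v) (res v)

  levelOrder : DecTotalOrder _ _ _
  levelOrder = On.decTotalOrder ≤-decTotalOrder lv

  order : List (Fin n)
  order = Sort.sort levelOrder (allFin n)

  order↭ : order ↭ allFin n
  order↭ = Sort.sort-↭ levelOrder (allFin n)

  topological : AllPairs (λ u v → arc G v u ≡ false) order
  topological = AllPairs.map no-back (Sorted⇒AllPairs (DecTotalOrder.totalOrder levelOrder) (Sort.sort-↗ levelOrder (allFin n)))
    where
    no-back : ∀ {u v} → lv u ≤ lv v → arc G v u ≡ false
    no-back {u} {v} u≤v with arc G v u in a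
    ... | false = refl
    ... | true = ⊥-elim (<-irrefl refl (<-≤-trans (proj₁ (graded v u a)) u≤v))

  count-order : (p : Fin n → Bool) → count p order ≡ count p (allFin n)
  count-order p = ↭-length (filter-↭ (T? ∘ p) order↭)

  open Embedding Fin._≟_ Fin._≟_ (arc G) (loopless G) E blk (θ ∘ blk) S
    (λ v → Unique-⊆ (Ch.S⊆M (blk<n v) (res<w v)) M-unique) Δ

  position : Fin n → ℕ × ℕ
  position u = blk u , res u

  few-bad : ∀ v → bad order v (S v) < product (map (θ ∘ blk) (inNbrs v order))
  few-bad v = subst₂ (λ l k → badTuples E (suc Δ * θ (blk v)) l (S v) < product k)
    (sym (map-∘ {g = uncurry Ch.S} {f = position} nbrs)) (sym (map-∘ {g = θ ∘ proj₁} {f = position} nbrs))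
    (Ch.few-bad (map position nbrs) (blk<n v) (res<w v) few all-precede)
    where
    nbrs : List (Fin n)
    nbrs = inNbrs v order
    few : length (map position nbrs) ≤ Δ
    few = ≤-trans (≤-reflexive (trans (length-map position nbrs) (count-order (λ u → arc G u v)))) (indegree-≤ v)
    Before : ℕ × ℕ → Set
    Before = Chain.Precedes E E-pair Δ w 1≤Δ 1≤w n (blk v) (res v)
    precedes : ∀ u → arc G u v ≡ true → Before (position u)
    precedes u a = cases (Cp.arc-blocks u v a)
      where
      cases : (blk u ≡ suc (blk v)) ⊎ (blk u ≡ blk v × res u < res v) → Before (position u)
      cases (inj₁ e) = res<w u , inj₁ (e , subst (_< n) e (blk<n u))
      cases (inj₂ (e , r<)) = res<w u , inj₂ (e , r<)
    all-precede : All Before (map position nbrs)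
    all-precede = All.map⁺ (All.tabulate (λ {u} u∈ → precedes u (proj₂ (∈-filterᵇ⁻ (λ u → arc G u v) {xs = order} u∈))))

  x₀ : Fin N
  x₀ = fromℕ< (≤-trans (*-mono-≤ (Constants.1≤D Δ w) (*-mono-≤ {1} {6} (s≤s z≤n) 1≤n)) N≥)

  module Em = Embeds (embed x₀ order S (λ _ → []) topological (Unique-↭ (↭-sym order↭) (allFin⁺ n))
    (λ u → ≤-trans (≤-reflexive (count-order (arc G u))) (outdegree-≤ u))
    (λ _ → ⊆-refl)
    (λ {v} _ → ≤-trans (≤-reflexive (count-order (sameBlock v))) (smooth-≥ population (blk v)))
    (λ {v} _ → few-bad v))

  ∈-order : ∀ v → v ∈ order
  ∈-order v = ∈-resp-↭ (↭-sym order↭) (∈-allFin v)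

  copy : ContainsCopy T G
  copy = Em.φ , injective , λ u v a → Em.φ-arc (∈-order u) (∈-order v) a
    where
    -- Within a block the excluded images keep vertices apart; across blocks the candidate sets are
    -- disjoint.
    injective : ∀ {u v} → Em.φ u ≡ Em.φ v → u ≡ v
    injective {u} {v} e = decide (u Fin.≟ v) (blk u ≟ blk v)
      where
      decide : Dec (u ≡ v) → Dec (blk u ≡ blk v) → u ≡ v
      decide (yes u≡v) _ = u≡v
      decide (no u≢v) (yes same) = ⊥-elim (Em.φ-inj (∈-order u) (∈-order v) u≢v same e)
      decide (no _) (no differ) = ⊥-elim (Ch.disjoint (blk<n u) (blk<n v) (res<w u) (res<w v) differ
        (Em.φ∈ (∈-order u)) (subst (_∈ S v) (sym e) (Em.φ∈ (∈-order v))))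

-- Covers the degenerate cases Δ = 0, w = 0 and n = 0, each of which rules out arcs; then any
-- injection is a copy.
arcless-forces : {n : ℕ} (G : Digraph n) (k : ℕ) → (∀ {u v} → arc G u v ≡ true → ⊥) →
  OrientedRamseyAtMost G (3 ^ k * n)
arcless-forces {n} G k none = n ,
  ≤-trans (≤-reflexive (sym (*-identityˡ n))) (*-monoˡ-≤ n (m^n>0 3 k)) ,
  λ T → id , id , λ u v a → ⊥-elim (none a)

theorem1p7 : (Δ w n : ℕ) (G : Digraph n) →
    maxDegree G ≡ Δ →
    HasGradedBandwidthAtMost G w →
    OrientedRamseyAtMost G (3 ^ (57 * Δ * w) * ∣V∣ G)
theorem1p7 _ w n G refl (_ , level , graded) = decide (1 ≤? maxDegree G) (1 ≤? w) (1 ≤? n)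
  where
  exponent : ℕ
  exponent = 57 * maxDegree G * w
  decide : Dec (1 ≤ maxDegree G) → Dec (1 ≤ w) → Dec (1 ≤ n) → OrientedRamseyAtMost G (3 ^ exponent * n)
  decide (no Δ≱1) _ _ = arcless-forces G exponent (λ a → Δ≱1 (Degrees.maxDegree-≥1 G a))
  decide (yes _) (no w≱1) _ = arcless-forces G exponent
    (λ {u} {v} a → w≱1 (+-cancelˡ-≤ (toℕ (level u)) _ _
      (≤-trans (≤-reflexive (+-comm (toℕ (level u)) 1)) (≤-trans (proj₁ (graded u v a)) (proj₂ (graded u v a))))))
  decide (yes _) (yes _) (no n≱1) = arcless-forces G exponent
    (λ {u} _ → n≱1 (≤-trans (s≤s z≤n) (Fin.toℕ<n u)))
  decide (yes 1≤Δ) (yes 1≤w) (yes 1≤n) = 3 ^ exponent * n , ≤-refl ,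
    λ T → Containment.copy G T w 1≤w 1≤Δ 1≤n (toℕ ∘ level) graded
      (≤-trans (≤-reflexive (sym (*-assoc (Constants.D (maxDegree G) w) 6 n)))
        (*-monoˡ-≤ n (D*6≤ (maxDegree G) w 1≤Δ 1≤w)))
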